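{- Let $(A_n,B_n)_{n\ge2}$ be the twin Seidel matrix sequence, $B_n=(b_n(m,k))$. Then, as formal power series in $x,y,z$, $$\sum b_{2n+1}(m,k)\frac{x^{m-1}}{(m-1)!}\frac{y^{k-m-1}}{(k-m-1)!}\frac{z^{2n-k}}{(2n-k)!}=\frac{\sin x\,\cos z\,\sin(x+y+z)}{\cos^2(x+y+z)},$$ the sum being over all integers $n\ge1$, $m,k$ with $2\le m+1\le k\le 2n$, and $$\sum b_{2n+1}(m,k)\frac{x^{2n-m}}{(2n-m)!}\frac{y^{m-k-1}}{(m-k-1)!}\frac{z^{k-1}}{(k-1)!}=-\frac{\sin x\,\sin z}{\cos(x+y+z)}+\frac{\cos x\,\cos(x+y)}{\cos^2(x+y+z)},$$ the sum being over all integers $n\ge1$, $m,k$ with $2\le k+1\le m\le 2n$.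
   Context: Twin Seidel matrix sequence: the unique sequence of square matrices $A_n=(a_n(m,k))_{1\le m,k\le n}$, $B_n=(b_n(m,k))_{1\le m,k\le n}$ ($n\ge2$) with nonnegative integer entries satisfying, with $a_n(m,\bullet)=\sum_k a_n(m,k)$, $a_n(\bullet,k)=\sum_m a_n(m,k)$ and similarly for $b$: (TS1) all diagonal entries are $0$, except $a_2(1,1)=1$; (TS2) for $n\ge3$: $a_n(m,n)=b_n(m,n)=0$ for all $m$, $a_n(n,k)=b_n(1,k)=0$ for all $k$, and $b_n(n,1)=0$; (TS3) $A_2=\begin{pmatrix}1&0\\0&0\end{pmatrix}$, $B_2=\begin{pmatrix}0&0\\1&0\end{pmatrix}$; (TS4) for $n\ge3$: $b_n(n,k)=a_{n-1}(\bullet,k-1)$ for $2\le k\le n-1$; $b_n(n-1,k)=a_{n-1}(\bullet,k)$ for $1\le k\le n-2$; $b_n(m+1,k)-b_n(m,k)=a_{n-1}(m,k)$ for $2\le k+1\le m\le n-2$; $b_n(m+1,k)-b_n(m,k)=a_{n-1}(m,k-1)$ for $3\le m+2\le k\le n-1$; (TS5) for $n\ge3$: $a_n(1,k)=b_{n-1}(\bullet,k-1)$ for $2\le k\le n-1$; $a_n(m+1,k)-a_n(m,k)=-b_{n-1}(m,k-1)$ for $3\le m+2\le k\le n-1$; $a_n(m+1,k)-a_n(m,k)=-b_{n-1}(m,k)$ for $2\le k+1\le m\le n-1$. -}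

module Defs where

open import Data.Bool using (Bool; true; false; if_then_else_)
open import Data.Nat as ℕ using (ℕ; zero; suc; _∸_; _≤_; _!; _≡ᵇ_)
import Data.Nat.Properties as ℕP
open import Data.Integer as ℤ using (ℤ; +_; -[1+_])
open import Data.Rational using (ℚ; _/_; 0ℚ; 1ℚ; _+_; _*_; -_)
open import Data.List using (List; []; _∷_; map; zipWith; foldr; upTo)
open import Data.Product using (_×_)
open import Relation.Binary.PropositionalEquality using (_≡_)
open import Relation.Nullary using (¬_)

-- Twin Seidel matrix sequence.
-- Matrices are encoded as functions  a n m k  =  a_n(m,k)  (entries for
-- 1 ≤ m,k ≤ n are the meaningful ones; other values are unconstrained).

Σ₁ : ℕ → (ℕ → ℕ) → ℕ
Σ₁ zero    f = 0
Σ₁ (suc N) f = Σ₁ N f ℕ.+ f (suc N)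

colSum : (ℕ → ℕ → ℕ → ℕ) → ℕ → ℕ → ℕ
colSum c N k = Σ₁ N (λ m → c N m k)

Mat : Set
Mat = ℕ → ℕ → ℕ → ℕ

-- The defining conditions (TS1)–(TS5).  Differences in (TS4),(TS5) are
-- written additively, as all entries are natural numbers.
record TwinSeidel (a b : Mat) : Set where
  field
    ts1a : ∀ n m → 2 ≤ n → 1 ≤ m → m ≤ n → ¬ (n ≡ 2 × m ≡ 1) → a n m m ≡ 0
    ts1b : ∀ n m → 2 ≤ n → 1 ≤ m → m ≤ n → b n m m ≡ 0
    ts2-aCol : ∀ n m → 3 ≤ n → 1 ≤ m → m ≤ n → a n m n ≡ 0
    ts2-bCol : ∀ n m → 3 ≤ n → 1 ≤ m → m ≤ n → b n m n ≡ 0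
    ts2-aRow : ∀ n k → 3 ≤ n → 1 ≤ k → k ≤ n → a n n k ≡ 0
    ts2-bRow : ∀ n k → 3 ≤ n → 1 ≤ k → k ≤ n → b n 1 k ≡ 0
    ts2-bCorner : ∀ n → 3 ≤ n → b n n 1 ≡ 0
    ts3-a11 : a 2 1 1 ≡ 1
    ts3-a12 : a 2 1 2 ≡ 0
    ts3-a21 : a 2 2 1 ≡ 0
    ts3-a22 : a 2 2 2 ≡ 0
    ts3-b11 : b 2 1 1 ≡ 0
    ts3-b12 : b 2 1 2 ≡ 0
    ts3-b21 : b 2 2 1 ≡ 1
    ts3-b22 : b 2 2 2 ≡ 0
    ts4-last : ∀ n k → 3 ≤ n → 2 ≤ k → k ≤ n ∸ 1 →
               b n n k ≡ colSum a (n ∸ 1) (k ∸ 1)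
    ts4-penult : ∀ n k → 3 ≤ n → 1 ≤ k → k ≤ n ∸ 2 →
               b n (n ∸ 1) k ≡ colSum a (n ∸ 1) k
    ts4-below : ∀ n m k → 3 ≤ n → 2 ≤ suc k → suc k ≤ m → m ≤ n ∸ 2 →
               b n (suc m) k ≡ b n m k ℕ.+ a (n ∸ 1) m k
    ts4-above : ∀ n m k → 3 ≤ n → 3 ≤ m ℕ.+ 2 → m ℕ.+ 2 ≤ k → k ≤ n ∸ 1 →
               b n (suc m) k ≡ b n m k ℕ.+ a (n ∸ 1) m (k ∸ 1)
    ts5-first : ∀ n k → 3 ≤ n → 2 ≤ k → k ≤ n ∸ 1 →
               a n 1 k ≡ colSum b (n ∸ 1) (k ∸ 1)
    ts5-above : ∀ n m k → 3 ≤ n → 3 ≤ m ℕ.+ 2 → m ℕ.+ 2 ≤ k → k ≤ n ∸ 1 →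
               a n m k ≡ a n (suc m) k ℕ.+ b (n ∸ 1) m (k ∸ 1)
    ts5-below : ∀ n m k → 3 ≤ n → 2 ≤ suc k → suc k ≤ m → m ≤ n ∸ 1 →
               a n m k ≡ a n (suc m) k ℕ.+ b (n ∸ 1) m k

-- Formal power series over ℚ.
-- Ser1 : one variable t (coefficient of t^n);
-- Ser3 : three variables x,y,z (coefficient of x^i y^j z^l).

Ser1 : Set
Ser1 = ℕ → ℚ

Ser3 : Set
Ser3 = ℕ → ℕ → ℕ → ℚ

ℕ→ℚ : ℕ → ℚ
ℕ→ℚ n = (+ n) / 1

invFact : ℕ → ℚ
invFact n = ((+ 1) / (n !)) {{n ℕP.!≢0}}

sumℚ : List ℚ → ℚ
sumℚ = foldr _+_ 0ℚ

sumTo : ℕ → (ℕ → ℚ) → ℚ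
sumTo zero    f = f 0
sumTo (suc n) f = sumTo n f + f (suc n)

sinSgn : ℕ → ℤ
sinSgn 0 = + 0
sinSgn 1 = + 1
sinSgn 2 = + 0
sinSgn 3 = -[1+ 0 ]
sinSgn (suc (suc (suc (suc n)))) = sinSgn n

cosSgn : ℕ → ℤ
cosSgn 0 = + 1
cosSgn 1 = + 0
cosSgn 2 = -[1+ 0 ]
cosSgn 3 = + 0
cosSgn (suc (suc (suc (suc n)))) = cosSgn n

sinS : Ser1
sinS n = ((sinSgn n) / 1) * invFact n

cosS : Ser1
cosS n = ((cosSgn n) / 1) * invFact n

_*₁_ : Ser1 → Ser1 → Ser1
(f *₁ g) n = sumTo n (λ a → f a * g (n ∸ a))

-- multiplicative inverse of a one-variable series with constant term 1:
-- g 0 = 1,  g (n+1) = - Σ_{k=1}^{n+1} f k * g (n+1-k).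
-- recipRev f n = [g n , g (n-1) , ... , g 0]
recipRev : Ser1 → ℕ → List ℚ
recipRev f zero    = 1ℚ ∷ []
recipRev f (suc n) =
  let gs = recipRev f n in
  (- sumℚ (zipWith _*_ (map (λ k → f (suc k)) (upTo (suc n))) gs)) ∷ gs

hd : List ℚ → ℚ
hd []      = 0ℚ
hd (x ∷ _) = x

recip₁ : Ser1 → Ser1
recip₁ f n = hd (recipRev f n)

_⊕_ : Ser3 → Ser3 → Ser3
(f ⊕ g) i j l = f i j l + g i j l

⊖_ : Ser3 → Ser3
(⊖ f) i j l = - f i j l

_⊛_ : Ser3 → Ser3 → Ser3
(f ⊛ g) i j l =
  sumTo i (λ a → sumTo j (λ b → sumTo l (λ c →
    f a b c * g (i ∸ a) (j ∸ b) (l ∸ c))))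

infixl 6 _⊕_
infixl 7 _⊛_

atX : Ser1 → Ser3
atX f i zero zero = f i
atX f i _    _    = 0ℚ

atZ : Ser1 → Ser3
atZ f zero zero l = f l
atZ f _    _    l = 0ℚ

-- f(x+y):  f_{i+j} (x+y)^{i+j} contributes f_{i+j} (i+j)!/(i! j!) to x^i y^j
atXY : Ser1 → Ser3
atXY f i j zero    = f (i ℕ.+ j) * ℕ→ℚ ((i ℕ.+ j) !) * invFact i * invFact j
atXY f i j (suc l) = 0ℚ

-- f(x+y+z): contributes f_{i+j+l} (i+j+l)!/(i! j! l!) to x^i y^j z^l
atXYZ : Ser1 → Ser3
atXYZ f i j l =
  f (i ℕ.+ j ℕ.+ l) * ℕ→ℚ ((i ℕ.+ j ℕ.+ l) !) * invFact i * invFact j * invFact l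

isEven : ℕ → Bool
isEven zero          = true
isEven (suc zero)    = false
isEven (suc (suc n)) = isEven n

-- Σ b_{2n+1}(m,k) x^{m-1}/(m-1)! y^{k-m-1}/(k-m-1)! z^{2n-k}/(2n-k)!
-- over n ≥ 1, 2 ≤ m+1 ≤ k ≤ 2n.  The monomial x^i y^j z^l arises exactly
-- once, from m = i+1, k = i+j+2, 2n = i+j+l+2, when i+j+l is even.
gfUpper : Mat → Ser3
gfUpper b i j l =
  if isEven (i ℕ.+ j ℕ.+ l)
  then ℕ→ℚ (b (i ℕ.+ j ℕ.+ l ℕ.+ 3) (suc i) (i ℕ.+ j ℕ.+ 2))
         * invFact i * invFact j * invFact l
  else 0ℚ

-- Σ b_{2n+1}(m,k) x^{2n-m}/(2n-m)! y^{m-k-1}/(m-k-1)! z^{k-1}/(k-1)!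
-- over n ≥ 1, 2 ≤ k+1 ≤ m ≤ 2n.  The monomial x^i y^j z^l arises exactly
-- once, from k = l+1, m = j+l+2, 2n = i+j+l+2, when i+j+l is even.
gfLower : Mat → Ser3
gfLower b i j l =
  if isEven (i ℕ.+ j ℕ.+ l)
  then ℕ→ℚ (b (i ℕ.+ j ℕ.+ l ℕ.+ 3) (j ℕ.+ l ℕ.+ 2) (suc l))
         * invFact i * invFact j * invFact l
  else 0ℚ

rhsUpper : Ser3
rhsUpper = atX sinS ⊛ atZ cosS ⊛ atXYZ sinS ⊛ atXYZ (recip₁ (cosS *₁ cosS))

rhsLower : Ser3
rhsLower = (⊖ (atX sinS ⊛ atZ sinS ⊛ atXYZ (recip₁ cosS)))
         ⊕ atX cosS ⊛ atXY cosS ⊛ atXYZ (recip₁ (cosS *₁ cosS))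

{-# OPTIONS --safe #-}
module Submission where

-- The differences in (TS4) and (TS5) say that δ = ∂/∂x - ∂/∂y maps the
-- exponential generating function BU of the entries of the matrices B above the
-- diagonal to its analogue AU for A, and AU to -BU; below the diagonal δ maps BL to -AL and
-- AL to BL.  The column sums in (TS4) and (TS5) telescope, and what remains of
-- these conditions is that the two triangles agree along the diagonal (y = 0),
-- except for the first entry, and that ∂AL/∂z = BL at x = 0.  Together with
-- BU = 0 at x = 0 and AL = 0 at x = z = 0 this determines all four series, degree
-- by degree.  With s = x + y + z, the closed forms
--   AU = cos x cos z sin s / cos² s,    AL = cos x sin z / cos s + sin x cos(x + y) / cos² s,
--   BU = sin x cos z sin s / cos² s,    BL = - sin x sin z / cos s + cos x cos(x + y) / cos² s
-- solve the same system, because δ annihilates functions of z, x + y and s.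

-- The exceptional first entry comes from a_2(1,1) = 1, the only nonzero diagonal entry: it makes
-- b_3(2,1) = 1, while b_3(1,2) = 0. In the closed forms it is the constant 1 that splits off from
-- cos² z / cos² s on y = 0. Products of exponential series are awkward to compare by coefficients.
-- Most product laws, the substitution of x + y + z, and the trigonometric identities are therefore
-- proved by comparing derivatives and initial values; the only convolution argument behind this is
-- the Leibniz rule. Setting a variable to 0 means comparing only the monomials free of it, so
-- identities that hold only on a face are still identities in a commutative ring. The ring solver
-- has natural coefficients, which is why equations are mostly arranged without subtraction.

open import Defs
open import Algebra.Bundles using (CommutativeRing)
import Algebra.Properties.Ring as RingProperties
import Algebra.Solver.Ring.NaturalCoefficients.Default as SemiringSolver
open import Data.Bool using (Bool; true; false; if_then_else_; not)
open import Data.Bool.Properties using (not-involutive)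
open import Data.Integer as ℤ using (ℤ; +_)
import Data.Integer.Properties as ℤP
open import Data.List using (List; []; _∷_; map; zipWith; foldr; upTo; applyUpTo)
open import Data.Nat as ℕ using (ℕ; zero; suc; _∸_; _≤_; _<_; z≤n; s≤s; _!)
import Data.Nat.Properties as ℕP
open import Data.Product using (_×_; _,_)
open import Data.Rational using (ℚ; _/_; 0ℚ; 1ℚ; _+_; _*_; -_; toℚᵘ)
import Data.Rational.Properties as ℚP
open import Data.Rational.Solver using (module +-*-Solver)
open import Data.Rational.Unnormalised as ℚᵘ using (mkℚᵘ; *≡*)
import Data.Rational.Unnormalised.Properties as ℚᵘP
open import Data.Unit using (⊤; tt)
open import Algebra.Properties.Group ℚP.+-0-group using (inverseˡ-unique)
open import Function using (_∘_; id)
open import Level using (0ℓ)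
import Relation.Binary.Reasoning.Setoid as SetoidReasoning
open import Relation.Binary.PropositionalEquality using (_≡_; _≗_; refl; sym; trans; cong; cong₂; subst; module ≡-Reasoning)
open import Relation.Binary.Structures using (IsEquivalence)

-- Polynomial identities in a commutative ring

module Algebraic {a ℓ} (A : CommutativeRing a ℓ) where
  open CommutativeRing A renaming (_+_ to _⊹_; _*_ to _·_; -_ to negate; refl to ≋-refl; sym to ≋-sym; trans to ≋-trans; setoid to ≋-setoid)
  open SemiringSolver commutativeSemiring
  open SetoidReasoning ≋-setoid

  -- The Leibniz expansion of (c x + s y)′ when s′ = c and y′ = x are already inserted. The
  -- relations c′ = -s and x′ = -y enter as vanishing sums.
  vanishing-sum : ∀ {p q p′ q′} x y → p′ ⊹ p ≈ 0# → q′ ⊹ q ≈ 0# →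
    (p′ · x ⊹ y · q′) ⊹ (y · q ⊹ p · x) ≈ 0#
  vanishing-sum {p} {q} {p′} {q′} x y p₀ q₀ = begin
    (p′ · x ⊹ y · q′) ⊹ (y · q ⊹ p · x)
      ≈⟨ solve 6 (λ p q p′ q′ x y → (p′ :* x :+ y :* q′) :+ (y :* q :+ p :* x) := (p′ :+ p) :* x :+ y :* (q′ :+ q)) ≋-refl p q p′ q′ x y ⟩
    (p′ ⊹ p) · x ⊹ y · (q′ ⊹ q)  ≈⟨ +-cong (*-congʳ p₀) (*-congˡ q₀) ⟩
    0# · x ⊹ y · 0#              ≈⟨ solve 2 (λ x y → con 0 :* x :+ y :* con 0 := con 0) ≋-refl x y ⟩
    0#                           ∎

  subtract : ∀ {q r t} → r ≈ t ⊹ q → negate q ⊹ r ≈ t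
  subtract {q} {r} {t} e = begin
    negate q ⊹ r        ≈⟨ +-congˡ e ⟩
    negate q ⊹ (t ⊹ q)  ≈⟨ solve 3 (λ n t q → n :+ (t :+ q) := t :+ (n :+ q)) ≋-refl (negate q) t q ⟩
    t ⊹ (negate q ⊹ q)  ≈⟨ +-congˡ (-‿inverseˡ q) ⟩
    t ⊹ 0#              ≈⟨ +-identityʳ t ⟩
    t                   ∎

  -- Writing c, s for cos, sin of u+w and cu, su, cw, sw for those of u and w.
  module _ {c s cu su cw sw}
    (pythagoras : cu · cu ⊹ su · su ≈ 1#)
    (cos-sub : c · cu ⊹ s · su ≈ cw)
    (sin-sub : cu · s ≈ su · c ⊹ sw) where

    -- Expanding `cw` by `cos-sub` and then `cu · s` by `sin-sub` leaves `c` times the Pythagorean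
    -- sum.
    cos-add : cu · cw ≈ c ⊹ su · sw
    cos-add = begin
      cu · cw                            ≈⟨ *-congˡ cos-sub ⟨
      cu · (c · cu ⊹ s · su)             ≈⟨ solve 4 (λ c s cu su → cu :* (c :* cu :+ s :* su) := c :* (cu :* cu) :+ su :* (cu :* s)) ≋-refl c s cu su ⟩
      c · (cu · cu) ⊹ su · (cu · s)      ≈⟨ +-congˡ (*-congˡ sin-sub) ⟩
      c · (cu · cu) ⊹ su · (su · c ⊹ sw) ≈⟨ solve 4 (λ c cu su sw → c :* (cu :* cu) :+ su :* (su :* c :+ sw) := c :* (cu :* cu :+ su :* su) :+ su :* sw) ≋-refl c cu su sw ⟩
      c · (cu · cu ⊹ su · su) ⊹ su · sw  ≈⟨ +-congʳ (≋-trans (*-congˡ pythagoras) (*-identityʳ c)) ⟩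
      c ⊹ su · sw                        ∎

    module _ {r p} (secant : c · r ≈ 1#) (secant² : p ≈ r · r) where

      -- Expanding one factor `cw` by `cos-sub` splits off the term with `s`. In the rest, `c · r`
      -- cancels and leaves `r · (cu · cw)`, which `cos-add` turns into 1 plus the secant term.
      lower-diagonal : cw · cw · p ≈ (su · cw · s · p ⊹ 1#) ⊹ sw · su · r
      lower-diagonal = begin
        cw · cw · p                                  ≈⟨ *-cong (*-congʳ (≋-sym cos-sub)) secant² ⟩
        (c · cu ⊹ s · su) · cw · (r · r)             ≈⟨ solve 6 (λ c s cu su cw r → (c :* cu :+ s :* su) :* cw :* (r :* r) := su :* cw :* s :* (r :* r) :+ (c :* r) :* r :* (cu :* cw)) ≋-refl c s cu su cw r ⟩
        su · cw · s · (r · r) ⊹ (c · r) · r · (cu · cw) ≈⟨ +-cong (*-congˡ (≋-sym secant²)) (*-cong (*-congʳ secant) cos-add) ⟩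
        su · cw · s · p ⊹ 1# · r · (c ⊹ su · sw)     ≈⟨ solve 5 (λ c su sw r t → t :+ con 1 :* r :* (c :+ su :* sw) := (t :+ c :* r) :+ sw :* su :* r) ≋-refl c su sw r (su · cw · s · p) ⟩
        (su · cw · s · p ⊹ c · r) ⊹ sw · su · r      ≈⟨ +-congʳ (+-congˡ secant) ⟩
        (su · cw · s · p ⊹ 1#) ⊹ sw · su · r         ∎

      -- After `sin-sub` replaces `cu · s`, the factor `c` lowers the squared secant to a secant.
      upper-diagonal : cu · cw · s · p ≈ cw · su · r ⊹ sw · cw · p
      upper-diagonal = begin
        cu · cw · s · p                        ≈⟨ solve 4 (λ s cu cw p → cu :* cw :* s :* p := cw :* (cu :* s) :* p) ≋-refl s cu cw p ⟩
        cw · (cu · s) · p                      ≈⟨ *-congʳ (*-congˡ sin-sub) ⟩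
        cw · (su · c ⊹ sw) · p                 ≈⟨ solve 5 (λ c su sw cw p → cw :* (su :* c :+ sw) :* p := cw :* su :* (c :* p) :+ sw :* cw :* p) ≋-refl c su sw cw p ⟩
        cw · su · (c · p) ⊹ sw · cw · p        ≈⟨ +-congʳ (*-congˡ c·p≈r) ⟩
        cw · su · r ⊹ sw · cw · p              ∎
        where
        c·p≈r : c · p ≈ r
        c·p≈r = begin
          c · p        ≈⟨ *-congˡ secant² ⟩
          c · (r · r)  ≈⟨ *-assoc c r r ⟨
          c · r · r    ≈⟨ *-congʳ secant ⟩
          1# · r       ≈⟨ *-identityˡ r ⟩
          r            ∎

  -- Uniqueness of inverses. It is needed because the closed forms divide by the series cos², so `p`
  -- is given as the inverse of a square.
  secant-squared : ∀ {c r p} → c · r ≈ 1# → (c · c) · p ≈ 1# → p ≈ r · r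
  secant-squared {c} {r} {p} cr ccp = begin
    p                        ≈⟨ solve 1 (λ p → p := con 1 :* con 1 :* p) ≋-refl p ⟩
    1# · 1# · p              ≈⟨ *-congʳ (*-cong cr cr) ⟨
    (c · r) · (c · r) · p    ≈⟨ solve 3 (λ c r p → (c :* r) :* (c :* r) :* p := r :* r :* ((c :* c) :* p)) ≋-refl c r p ⟩
    r · r · ((c · c) · p)    ≈⟨ *-congˡ ccp ⟩
    r · r · 1#               ≈⟨ *-identityʳ (r · r) ⟩
    r · r                    ∎

  -- The last hypothesis is the derivative of `c · r ≈ 1#`; multiplying it by `r` isolates `r′`.
  secant-derivative : ∀ {c s r c′ r′} → c · r ≈ 1# → c′ ⊹ s ≈ 0# → c′ · r ⊹ c · r′ ≈ 0# → r′ ≈ r · r · s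
  secant-derivative {c} {s} {r} {c′} {r′} cr c′+s eq = begin
    r′                                          ≈⟨ solve 1 (λ r′ → r′ := con 1 :* r′) ≋-refl r′ ⟩
    1# · r′                                     ≈⟨ *-congʳ cr ⟨
    c · r · r′                                  ≈⟨ solve 3 (λ c r r′ → c :* r :* r′ := r :* (c :* r′) :+ con 0 :* (r :* r)) ≋-refl c r r′ ⟩
    r · (c · r′) ⊹ 0# · (r · r)                 ≈⟨ +-congˡ (*-congʳ c′+s) ⟨
    r · (c · r′) ⊹ (c′ ⊹ s) · (r · r)           ≈⟨ solve 5 (λ c r r′ c′ s → r :* (c :* r′) :+ (c′ :+ s) :* (r :* r) := r :* (c′ :* r :+ c :* r′) :+ r :* r :* s) ≋-refl c r r′ c′ s ⟩
    r · (c′ · r ⊹ c · r′) ⊹ r · r · s           ≈⟨ +-congʳ (*-congˡ eq) ⟩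
    r · 0# ⊹ r · r · s                          ≈⟨ solve 2 (λ r s → r :* con 0 :+ r :* r :* s := r :* r :* s) ≋-refl r s ⟩
    r · r · s                                   ∎

  -- The left side is the z-derivative of sin z / cos(x + y + z). Inserting `c · r` into its first
  -- term makes the numerator the expansion of cos(x + y), here `k`.
  edge : ∀ {c s r p k cw sw} → c · r ≈ 1# → p ≈ r · r → cw · c ⊹ sw · s ≈ k →
    cw · r ⊹ sw · (r · r · s) ≈ k · p
  edge {c} {s} {r} {p} {k} {cw} {sw} cr prr ke = begin
    cw · r ⊹ sw · (r · r · s)              ≈⟨ +-congʳ (*-congʳ (*-identityʳ cw)) ⟨
    cw · 1# · r ⊹ sw · (r · r · s)         ≈⟨ +-congʳ (*-congʳ (*-congˡ cr)) ⟨
    cw · (c · r) · r ⊹ sw · (r · r · s)    ≈⟨ solve 5 (λ c s r cw sw → cw :* (c :* r) :* r :+ sw :* (r :* r :* s) := (cw :* c :+ sw :* s) :* (r :* r)) ≋-refl c s r cw sw ⟩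
    (cw · c ⊹ sw · s) · (r · r)            ≈⟨ *-cong ke (≋-sym prr) ⟩
    k · p                                  ∎

-- Rational factorials

/1-+ : ∀ p q → (p ℤ.+ q) / 1 ≡ p / 1 + q / 1
/1-+ p q = ℚP.toℚᵘ-injective (begin
  toℚᵘ ((p ℤ.+ q) / 1)              ≈⟨ ℚP.toℚᵘ-fromℚᵘ (mkℚᵘ (p ℤ.+ q) 0) ⟩
  mkℚᵘ (p ℤ.+ q) 0                  ≈⟨ *≡* (cong (ℤ._* + 1) (sym (cong₂ ℤ._+_ (ℤP.*-identityʳ p) (ℤP.*-identityʳ q)))) ⟩
  mkℚᵘ p 0 ℚᵘ.+ mkℚᵘ q 0            ≈⟨ ℚᵘP.+-cong (ℚP.toℚᵘ-fromℚᵘ (mkℚᵘ p 0)) (ℚP.toℚᵘ-fromℚᵘ (mkℚᵘ q 0)) ⟨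
  toℚᵘ (p / 1) ℚᵘ.+ toℚᵘ (q / 1)    ≈⟨ ℚP.toℚᵘ-homo-+ (p / 1) (q / 1) ⟨
  toℚᵘ (p / 1 + q / 1)              ∎)
  where open ℚᵘP.≃-Reasoning

/1-* : ∀ p q → (p ℤ.* q) / 1 ≡ p / 1 * (q / 1)
/1-* p q = ℚP.toℚᵘ-injective (begin
  toℚᵘ ((p ℤ.* q) / 1)              ≈⟨ ℚP.toℚᵘ-fromℚᵘ (mkℚᵘ (p ℤ.* q) 0) ⟩
  mkℚᵘ p 0 ℚᵘ.* mkℚᵘ q 0            ≈⟨ ℚᵘP.*-cong (ℚP.toℚᵘ-fromℚᵘ (mkℚᵘ p 0)) (ℚP.toℚᵘ-fromℚᵘ (mkℚᵘ q 0)) ⟨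
  toℚᵘ (p / 1) ℚᵘ.* toℚᵘ (q / 1)    ≈⟨ ℚP.toℚᵘ-homo-* (p / 1) (q / 1) ⟨
  toℚᵘ (p / 1 * (q / 1))            ∎)
  where open ℚᵘP.≃-Reasoning

ℕ→ℚ-+ : ∀ m n → ℕ→ℚ (m ℕ.+ n) ≡ ℕ→ℚ m + ℕ→ℚ n
ℕ→ℚ-+ m n = /1-+ (+ m) (+ n)

ℕ→ℚ-* : ∀ m n → ℕ→ℚ (m ℕ.* n) ≡ ℕ→ℚ m * ℕ→ℚ n
ℕ→ℚ-* m n = trans (cong (_/ 1) (ℤP.pos-* m n)) (/1-* (+ m) (+ n))

ℕ→ℚ-inverse : ∀ m .{{_ : ℕ.NonZero m}} → ℕ→ℚ m * (+ 1 / m) ≡ 1ℚ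
ℕ→ℚ-inverse m@(suc d) = ℚP.toℚᵘ-injective (begin
  toℚᵘ (ℕ→ℚ m * (+ 1 / m))            ≈⟨ ℚP.toℚᵘ-homo-* (ℕ→ℚ m) (+ 1 / m) ⟩
  toℚᵘ (ℕ→ℚ m) ℚᵘ.* toℚᵘ (+ 1 / m)    ≈⟨ ℚᵘP.*-cong (ℚP.toℚᵘ-fromℚᵘ (mkℚᵘ (+ m) 0)) (ℚP.toℚᵘ-fromℚᵘ (mkℚᵘ (+ 1) d)) ⟩
  mkℚᵘ (+ m) 0 ℚᵘ.* mkℚᵘ (+ 1) d      ≈⟨ ℚᵘP.*-inverseʳ (mkℚᵘ (+ m) 0) ⟩
  mkℚᵘ (+ 1) 0                        ∎)
  where open ℚᵘP.≃-Reasoning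

!-invFact : ∀ n → ℕ→ℚ (n !) * invFact n ≡ 1ℚ
!-invFact n = ℕ→ℚ-inverse (n !) {{n ℕP.!≢0}}

suc-invFact : ∀ n → ℕ→ℚ (suc n) * invFact (suc n) ≡ invFact n
suc-invFact n = begin
  s * v                ≡⟨ ℚP.*-identityʳ (s * v) ⟨
  s * v * 1ℚ           ≡⟨ cong (s * v *_) (!-invFact n) ⟨
  s * v * (f * w)      ≡⟨ +-*-Solver.solve 4 (λ s v f w → s :* v :* (f :* w) := s :* f :* v :* w) refl s v f w ⟩
  s * f * v * w        ≡⟨ cong (λ t → t * v * w) (ℕ→ℚ-* (suc n) (n !)) ⟨
  ℕ→ℚ (suc n !) * v * w ≡⟨ cong (_* w) (!-invFact (suc n)) ⟩
  1ℚ * w               ≡⟨ ℚP.*-identityˡ w ⟩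
  w                    ∎
  where
  open ≡-Reasoning
  open +-*-Solver using (_:*_; _:=_)
  s = ℕ→ℚ (suc n)
  v = invFact (suc n)
  f = ℕ→ℚ (n !)
  w = invFact n

suc-cancel : ∀ n {p q} → ℕ→ℚ (suc n) * p ≡ ℕ→ℚ (suc n) * q → p ≡ q
suc-cancel n {p} {q} eq = trans (sym (undo p)) (trans (cong (u *_) eq) (undo q))
  where
  u = + 1 / suc n
  undo : ∀ r → u * (ℕ→ℚ (suc n) * r) ≡ r
  undo r = trans (sym (ℚP.*-assoc u (ℕ→ℚ (suc n)) r))
    (trans (cong (_* r) (trans (ℚP.*-comm u (ℕ→ℚ (suc n))) (ℕ→ℚ-inverse (suc n)))) (ℚP.*-identityˡ r))

+-interchange : ∀ p q r s → (p + q) + (r + s) ≡ (p + r) + (q + s)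
+-interchange = +-*-Solver.solve 4 (λ p q r s → (p :+ q) :+ (r :+ s) := (p :+ r) :+ (q :+ s)) refl
  where open +-*-Solver using (_:+_; _:=_)

x*yz≡y*xz : ∀ p q r → p * (q * r) ≡ q * (p * r)
x*yz≡y*xz = +-*-Solver.solve 3 (λ p q r → p :* (q :* r) := q :* (p :* r)) refl
  where open +-*-Solver using (_:*_; _:=_)

-- Finite sums

sumTo-cong≤ : ∀ n {f g : ℕ → ℚ} → (∀ a → a ≤ n → f a ≡ g a) → sumTo n f ≡ sumTo n g
sumTo-cong≤ zero    eq = eq 0 z≤n
sumTo-cong≤ (suc n) eq =
  cong₂ _+_ (sumTo-cong≤ n (λ a a≤n → eq a (ℕP.m≤n⇒m≤1+n a≤n))) (eq (suc n) ℕP.≤-refl)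

sumTo-cong : ∀ n {f g : ℕ → ℚ} → (∀ a → f a ≡ g a) → sumTo n f ≡ sumTo n g
sumTo-cong n eq = sumTo-cong≤ n (λ a _ → eq a)

sumTo-+ : ∀ n f g → sumTo n (λ a → f a + g a) ≡ sumTo n f + sumTo n g
sumTo-+ zero    f g = refl
sumTo-+ (suc n) f g = trans (cong (_+ (f (suc n) + g (suc n))) (sumTo-+ n f g))
  (+-interchange (sumTo n f) (sumTo n g) (f (suc n)) (g (suc n)))

sumTo-*ˡ : ∀ n p f → p * sumTo n f ≡ sumTo n (λ a → p * f a)
sumTo-*ˡ zero    p f = refl
sumTo-*ˡ (suc n) p f =
  trans (ℚP.*-distribˡ-+ p (sumTo n f) (f (suc n))) (cong (_+ p * f (suc n)) (sumTo-*ˡ n p f))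

sumTo-swap : ∀ m n (h : ℕ → ℕ → ℚ) →
  sumTo m (λ a → sumTo n (h a)) ≡ sumTo n (λ c → sumTo m (λ a → h a c))
sumTo-swap zero    n h = refl
sumTo-swap (suc m) n h = trans (cong (_+ sumTo n (h (suc m))) (sumTo-swap m n h))
  (sym (sumTo-+ n (λ c → sumTo m (λ a → h a c)) (h (suc m))))

sumTo-shift : ∀ n f → sumTo (suc n) f ≡ f 0 + sumTo n (f ∘ suc)
sumTo-shift zero    f = refl
sumTo-shift (suc n) f = trans (cong (_+ f (suc (suc n))) (sumTo-shift n f))
  (ℚP.+-assoc (f 0) (sumTo n (f ∘ suc)) (f (suc (suc n))))

-- The weight n+1 splits as a + (n+1-a) on each antidiagonal term: this is the
-- Leibniz rule for a Cauchy product.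
sumTo-leibniz : ∀ n (h : ℕ → ℕ → ℚ) →
  ℕ→ℚ (suc n) * sumTo (suc n) (λ a → h a (suc n ∸ a))
  ≡ sumTo n (λ a → ℕ→ℚ (suc a) * h (suc a) (n ∸ a))
  + sumTo n (λ a → ℕ→ℚ (suc (n ∸ a)) * h a (suc (n ∸ a)))
sumTo-leibniz n h = begin
  ℕ→ℚ N * sumTo N d                                  ≡⟨ sumTo-*ˡ N (ℕ→ℚ N) d ⟩
  sumTo N (λ a → ℕ→ℚ N * d a)                        ≡⟨ sumTo-cong≤ N split ⟩
  sumTo N (λ a → ℕ→ℚ a * d a + ℕ→ℚ (N ∸ a) * d a)    ≡⟨ sumTo-+ N (λ a → ℕ→ℚ a * d a) (λ a → ℕ→ℚ (N ∸ a) * d a) ⟩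
  sumTo N (λ a → ℕ→ℚ a * d a) + sumTo N (λ a → ℕ→ℚ (N ∸ a) * d a)
                                                     ≡⟨ cong₂ _+_ left right ⟩
  _                                                  ∎
  where
  open ≡-Reasoning
  N = suc n
  d : ℕ → ℚ
  d a = h a (N ∸ a)
  split : ∀ a → a ≤ N → ℕ→ℚ N * d a ≡ ℕ→ℚ a * d a + ℕ→ℚ (N ∸ a) * d a
  split a a≤N = begin
    ℕ→ℚ N * d a                       ≡⟨ cong (λ k → ℕ→ℚ k * d a) (ℕP.m+[n∸m]≡n a≤N) ⟨
    ℕ→ℚ (a ℕ.+ (N ∸ a)) * d a         ≡⟨ cong (_* d a) (ℕ→ℚ-+ a (N ∸ a)) ⟩
    (ℕ→ℚ a + ℕ→ℚ (N ∸ a)) * d a       ≡⟨ ℚP.*-distribʳ-+ (d a) (ℕ→ℚ a) (ℕ→ℚ (N ∸ a)) ⟩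
    ℕ→ℚ a * d a + ℕ→ℚ (N ∸ a) * d a   ∎
  left : sumTo N (λ a → ℕ→ℚ a * d a) ≡ sumTo n (λ a → ℕ→ℚ (suc a) * h (suc a) (n ∸ a))
  left = trans (sumTo-shift n (λ a → ℕ→ℚ a * d a))
    (trans (cong (_+ sumTo n (λ a → ℕ→ℚ (suc a) * h (suc a) (n ∸ a))) (ℚP.*-zeroˡ (d 0)))
      (ℚP.+-identityˡ _))
  right : sumTo N (λ a → ℕ→ℚ (N ∸ a) * d a) ≡ sumTo n (λ a → ℕ→ℚ (suc (n ∸ a)) * h a (suc (n ∸ a)))
  right = trans
    (cong₂ _+_
      (sumTo-cong≤ n (λ a a≤n → cong (λ k → ℕ→ℚ k * h a k) (ℕP.+-∸-assoc 1 a≤n)))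
      (trans (cong (λ k → ℕ→ℚ k * d N) (ℕP.n∸n≡0 n)) (ℚP.*-zeroˡ (d N))))
    (ℚP.+-identityʳ _)

-- The ring of power series in x, y, z

infix 4 _≈_

record _≈_ (f g : Ser3) : Set where
  constructor mk
  field at : ∀ i j l → f i j l ≡ g i j l

open _≈_

≈-refl : ∀ {f} → f ≈ f
≈-refl .at i j l = refl

≈-sym : ∀ {f g} → f ≈ g → g ≈ f
≈-sym p .at i j l = sym (at p i j l)

≈-trans : ∀ {f g h} → f ≈ g → g ≈ h → f ≈ h
≈-trans p q .at i j l = trans (at p i j l) (at q i j l)

𝟘 𝟙 : Ser3
𝟘 i j l = 0ℚ
𝟙 zero zero zero = 1ℚ
𝟙 _    _    _    = 0ℚ

-- Opaque copies of the series operations: the originals unfold to coefficients,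
-- which defeats the inference of their arguments.
opaque

  infixl 6 _⊞_
  infixl 7 _⊠_
  infix 8 ⊟_

  _⊞_ _⊠_ : Ser3 → Ser3 → Ser3
  _⊞_ = _⊕_
  _⊠_ = _⊛_

  ⊟_ : Ser3 → Ser3
  ⊟_ = ⊖_

opaque
  unfolding _⊞_

  ⊞-cong : ∀ {f f′ g g′} → f ≈ f′ → g ≈ g′ → f ⊞ g ≈ f′ ⊞ g′
  ⊞-cong p q .at i j l = cong₂ _+_ (at p i j l) (at q i j l)

  ⊟-cong : ∀ {f g} → f ≈ g → ⊟ f ≈ ⊟ g
  ⊟-cong p .at i j l = cong -_ (at p i j l)

  ⊠-cong : ∀ {f f′ g g′} → f ≈ f′ → g ≈ g′ → f ⊠ g ≈ f′ ⊠ g′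
  ⊠-cong p q .at i j l = sumTo-cong i λ a → sumTo-cong j λ b → sumTo-cong l λ c →
    cong₂ _*_ (at p a b c) (at q (i ∸ a) (j ∸ b) (l ∸ c))

data Var : Set where
  X Y Z : Var

private
  pull₁ : ∀ l p (u v : ℕ → ℚ) →
    p * sumTo l (λ c → u c * v c) ≡ sumTo l (λ c → p * u c * v c)
  pull₁ l p u v = trans (sumTo-*ˡ l p _) (sumTo-cong l λ c → sym (ℚP.*-assoc p (u c) (v c)))

  pull₁′ : ∀ l p (u v : ℕ → ℚ) →
    p * sumTo l (λ c → u c * v c) ≡ sumTo l (λ c → u c * (p * v c))
  pull₁′ l p u v = trans (sumTo-*ˡ l p _) (sumTo-cong l λ c → x*yz≡y*xz p (u c) (v c))

  pull₂ : ∀ j l p (u v : ℕ → ℕ → ℚ) →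
    p * sumTo j (λ b → sumTo l (λ c → u b c * v b c))
    ≡ sumTo j (λ b → sumTo l (λ c → p * u b c * v b c))
  pull₂ j l p u v = trans (sumTo-*ˡ j p _) (sumTo-cong j λ b → pull₁ l p (u b) (v b))

  pull₂′ : ∀ j l p (u v : ℕ → ℕ → ℚ) →
    p * sumTo j (λ b → sumTo l (λ c → u b c * v b c))
    ≡ sumTo j (λ b → sumTo l (λ c → u b c * (p * v b c)))
  pull₂′ j l p u v = trans (sumTo-*ˡ j p _) (sumTo-cong j λ b → pull₁′ l p (u b) (v b))

opaque
  unfolding _⊞_

  ∂ : Var → Ser3 → Ser3
  ∂ X f i j l = ℕ→ℚ (suc i) * f (suc i) j l
  ∂ Y f i j l = ℕ→ℚ (suc j) * f i (suc j) l
  ∂ Z f i j l = ℕ→ℚ (suc l) * f i j (suc l)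

  ∂-cong : ∀ v {f g} → f ≈ g → ∂ v f ≈ ∂ v g
  ∂-cong X p .at i j l = cong (ℕ→ℚ (suc i) *_) (at p (suc i) j l)
  ∂-cong Y p .at i j l = cong (ℕ→ℚ (suc j) *_) (at p i (suc j) l)
  ∂-cong Z p .at i j l = cong (ℕ→ℚ (suc l) *_) (at p i j (suc l))

  ∂-⊞ : ∀ v f g → ∂ v (f ⊞ g) ≈ ∂ v f ⊞ ∂ v g
  ∂-⊞ X f g .at i j l = ℚP.*-distribˡ-+ (ℕ→ℚ (suc i)) (f (suc i) j l) (g (suc i) j l)
  ∂-⊞ Y f g .at i j l = ℚP.*-distribˡ-+ (ℕ→ℚ (suc j)) (f i (suc j) l) (g i (suc j) l)
  ∂-⊞ Z f g .at i j l = ℚP.*-distribˡ-+ (ℕ→ℚ (suc l)) (f i j (suc l)) (g i j (suc l))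

  ∂-⊟ : ∀ v f → ∂ v (⊟ f) ≈ ⊟ ∂ v f
  ∂-⊟ X f .at i j l = sym (ℚP.neg-distribʳ-* (ℕ→ℚ (suc i)) (f (suc i) j l))
  ∂-⊟ Y f .at i j l = sym (ℚP.neg-distribʳ-* (ℕ→ℚ (suc j)) (f i (suc j) l))
  ∂-⊟ Z f .at i j l = sym (ℚP.neg-distribʳ-* (ℕ→ℚ (suc l)) (f i j (suc l)))

  ∂-𝟘 : ∀ v → ∂ v 𝟘 ≈ 𝟘
  ∂-𝟘 X .at i j l = ℚP.*-zeroʳ (ℕ→ℚ (suc i))
  ∂-𝟘 Y .at i j l = ℚP.*-zeroʳ (ℕ→ℚ (suc j))
  ∂-𝟘 Z .at i j l = ℚP.*-zeroʳ (ℕ→ℚ (suc l))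

  ∂-𝟙 : ∀ v → ∂ v 𝟙 ≈ 𝟘
  ∂-𝟙 X .at i j l = ℚP.*-zeroʳ (ℕ→ℚ (suc i))
  ∂-𝟙 Y .at zero j l = ℚP.*-zeroʳ (ℕ→ℚ (suc j))
  ∂-𝟙 Y .at (suc i) j l = ℚP.*-zeroʳ (ℕ→ℚ (suc j))
  ∂-𝟙 Z .at zero zero l = ℚP.*-zeroʳ (ℕ→ℚ (suc l))
  ∂-𝟙 Z .at zero (suc j) l = ℚP.*-zeroʳ (ℕ→ℚ (suc l))
  ∂-𝟙 Z .at (suc i) j l = ℚP.*-zeroʳ (ℕ→ℚ (suc l))

  -- `sumTo-leibniz` acts on the sum over the exponent of `v`; the weights then pass through the
  -- other sums into one of the two factors.
  ∂-⊠ : ∀ v f g → ∂ v (f ⊠ g) ≈ ∂ v f ⊠ g ⊞ f ⊠ ∂ v g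
  ∂-⊠ X f g .at i j l =
    trans (sumTo-leibniz i h) (cong₂ _+_
      (sumTo-cong i λ a → pull₂ j l (ℕ→ℚ (suc a)) (f (suc a)) (λ b c → g (i ∸ a) (j ∸ b) (l ∸ c)))
      (sumTo-cong i λ a → pull₂′ j l (ℕ→ℚ (suc (i ∸ a))) (f a) (λ b c → g (suc (i ∸ a)) (j ∸ b) (l ∸ c))))
    where
    h : ℕ → ℕ → ℚ
    h a a′ = sumTo j λ b → sumTo l λ c → f a b c * g a′ (j ∸ b) (l ∸ c)
  ∂-⊠ Y f g .at i j l =
    trans (sumTo-*ˡ i (ℕ→ℚ (suc j)) _) (trans
      (sumTo-cong i λ a → trans (sumTo-leibniz j (h a)) (cong₂ _+_
        (sumTo-cong j λ b → pull₁ l (ℕ→ℚ (suc b)) (f a (suc b)) (λ c → g (i ∸ a) (j ∸ b) (l ∸ c)))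
        (sumTo-cong j λ b → pull₁′ l (ℕ→ℚ (suc (j ∸ b))) (f a b) (λ c → g (i ∸ a) (suc (j ∸ b)) (l ∸ c)))))
      (sumTo-+ i _ _))
    where
    h : ℕ → ℕ → ℕ → ℚ
    h a b b′ = sumTo l λ c → f a b c * g (i ∸ a) b′ (l ∸ c)
  ∂-⊠ Z f g .at i j l =
    trans (sumTo-*ˡ i (ℕ→ℚ (suc l)) _) (trans
      (sumTo-cong i λ a → trans (sumTo-*ˡ j (ℕ→ℚ (suc l)) _) (trans
        (sumTo-cong j λ b → trans (sumTo-leibniz l (h a b)) (cong₂ _+_
          (sumTo-cong l λ c → sym (ℚP.*-assoc (ℕ→ℚ (suc c)) (f a b (suc c)) (g (i ∸ a) (j ∸ b) (l ∸ c))))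
          (sumTo-cong l λ c → x*yz≡y*xz (ℕ→ℚ (suc (l ∸ c))) (f a b c) (g (i ∸ a) (j ∸ b) (suc (l ∸ c))))))
        (sumTo-+ j _ _)))
      (sumTo-+ i _ _))
    where
    h : ℕ → ℕ → ℕ → ℕ → ℚ
    h a b c c′ = f a b c * g (i ∸ a) (j ∸ b) c′

⊞-sum : {I : Set} → (I → Ser3) → List I → Ser3
⊞-sum Φ = foldr (λ x s → Φ x ⊞ s) 𝟘

opaque
  unfolding _⊞_ ∂

  -- Two families of series that satisfy the same linear system of first-order
  -- equations and have the same constant terms agree.  Identities between
  -- products follow from this, with the family of all such products as index.
  taylor : {I : Set} (Φ Ψ : I → Ser3) (d : Var → I → List I) →
    (∀ v x → ∂ v (Φ x) ≈ ⊞-sum Φ (d v x)) →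
    (∀ v x → ∂ v (Ψ x) ≈ ⊞-sum Ψ (d v x)) →
    (∀ x → Φ x 0 0 0 ≡ Ψ x 0 0 0) →
    ∀ x → Φ x ≈ Ψ x
  taylor {I} Φ Ψ d Φ′ Ψ′ base x .at = agree x
    where
    sums : ∀ i j l → (∀ y → Φ y i j l ≡ Ψ y i j l) → ∀ ys → ⊞-sum Φ ys i j l ≡ ⊞-sum Ψ ys i j l
    sums i j l eq []       = refl
    sums i j l eq (y ∷ ys) = cong₂ _+_ (eq y) (sums i j l eq ys)

    step : ∀ v y i j l → (∀ z → Φ z i j l ≡ Ψ z i j l) → ∂ v (Φ y) i j l ≡ ∂ v (Ψ y) i j l
    step v y i j l eq = trans (at (Φ′ v y) i j l) (trans (sums i j l eq (d v y)) (sym (at (Ψ′ v y) i j l)))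

    agree : ∀ y i j l → Φ y i j l ≡ Ψ y i j l
    -- The derivative of one member involves other members, so the induction on the exponents must
    -- cover the whole family at once.
    agree y (suc i) j l = suc-cancel i (step X y i j l (λ z → agree z i j l))
    agree y zero (suc j) l = suc-cancel j (step Y y zero j l (λ z → agree z zero j l))
    agree y zero zero (suc l) = suc-cancel l (step Z y zero zero l (λ z → agree z zero zero l))
    agree y zero zero zero = base y

opaque
  unfolding _⊞_

  ⊠-at-0 : ∀ f g → (f ⊠ g) 0 0 0 ≡ f 0 0 0 * g 0 0 0
  ⊠-at-0 f g = refl

  ⊞-identityʳ : ∀ f → f ⊞ 𝟘 ≈ f
  ⊞-identityʳ f .at i j l = ℚP.+-identityʳ (f i j l)

  ⊞-identityˡ : ∀ f → 𝟘 ⊞ f ≈ f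
  ⊞-identityˡ f .at i j l = ℚP.+-identityˡ (f i j l)

  ⊞-comm : ∀ f g → f ⊞ g ≈ g ⊞ f
  ⊞-comm f g .at i j l = ℚP.+-comm (f i j l) (g i j l)

  ⊞-assoc : ∀ f g h → (f ⊞ g) ⊞ h ≈ f ⊞ (g ⊞ h)
  ⊞-assoc f g h .at i j l = ℚP.+-assoc (f i j l) (g i j l) (h i j l)

private
  two : ∀ {e f g} → e ≈ f ⊞ g → e ≈ f ⊞ (g ⊞ 𝟘)
  two p = ≈-trans p (⊞-cong ≈-refl (≈-sym (⊞-identityʳ _)))

⊠-comm : ∀ f g → f ⊠ g ≈ g ⊠ f
⊠-comm f g = taylor {Ser3 × Ser3} (λ (f , g) → f ⊠ g) (λ (f , g) → g ⊠ f)
  (λ v (f , g) → (∂ v f , g) ∷ (f , ∂ v g) ∷ [])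
  (λ v (f , g) → two (∂-⊠ v f g))
  (λ v (f , g) → two (≈-trans (∂-⊠ v g f) (⊞-comm _ _)))
  (λ (f , g) → trans (⊠-at-0 f g) (trans (ℚP.*-comm (f 0 0 0) (g 0 0 0)) (sym (⊠-at-0 g f))))
  (f , g)

opaque
  unfolding _⊞_

  ⊠-distribʳ : ∀ h f g → (f ⊞ g) ⊠ h ≈ f ⊠ h ⊞ g ⊠ h
  ⊠-distribʳ h f g .at i j l = trans
    (sumTo-cong i λ a → trans
      (sumTo-cong j λ b → trans
        (sumTo-cong l λ c → ℚP.*-distribʳ-+ (h (i ∸ a) (j ∸ b) (l ∸ c)) (f a b c) (g a b c))
        (sumTo-+ l _ _))
      (sumTo-+ j _ _))
    (sumTo-+ i _ _)

⊠-distribˡ : ∀ h f g → h ⊠ (f ⊞ g) ≈ h ⊠ f ⊞ h ⊠ g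
⊠-distribˡ h f g = ≈-trans (⊠-comm h (f ⊞ g))
  (≈-trans (⊠-distribʳ h f g) (⊞-cong (⊠-comm f h) (⊠-comm g h)))

⊠-assoc : ∀ f g h → (f ⊠ g) ⊠ h ≈ f ⊠ (g ⊠ h)
⊠-assoc f g h = taylor {Ser3 × Ser3 × Ser3}
  (λ (f , g , h) → (f ⊠ g) ⊠ h) (λ (f , g , h) → f ⊠ (g ⊠ h))
  (λ v (f , g , h) → (∂ v f , g , h) ∷ (f , ∂ v g , h) ∷ (f , g , ∂ v h) ∷ [])
  (λ v (f , g , h) → ≈-trans (∂-⊠ v (f ⊠ g) h)
    (≈-trans (⊞-cong (≈-trans (⊠-cong (∂-⊠ v f g) ≈-refl) (⊠-distribʳ h _ _)) ≈-refl)
      (≈-trans (⊞-assoc _ _ _) (⊞-cong ≈-refl (two ≈-refl)))))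
  (λ v (f , g , h) → ≈-trans (∂-⊠ v f (g ⊠ h))
    (⊞-cong ≈-refl (≈-trans (⊠-cong ≈-refl (∂-⊠ v g h)) (two (⊠-distribˡ f _ _)))))
  (λ (f , g , h) → trans (⊠-at-0 (f ⊠ g) h) (trans (cong (_* h 0 0 0) (⊠-at-0 f g))
    (trans (ℚP.*-assoc (f 0 0 0) (g 0 0 0) (h 0 0 0))
      (sym (trans (⊠-at-0 f (g ⊠ h)) (cong (f 0 0 0 *_) (⊠-at-0 g h)))))))
  (f , g , h)

⊠-zeroˡ : ∀ f → 𝟘 ⊠ f ≈ 𝟘
-- `f` stands in the list because the derivative of the left factor `𝟘` is `𝟘` again.
⊠-zeroˡ f = taylor {Ser3} (𝟘 ⊠_) (λ _ → 𝟘) (λ v f → f ∷ ∂ v f ∷ [])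
  (λ v f → two (≈-trans (∂-⊠ v 𝟘 f) (⊞-cong (⊠-cong (∂-𝟘 v) ≈-refl) ≈-refl)))
  (λ v f → two (≈-trans (∂-𝟘 v) (≈-sym (⊞-identityʳ 𝟘))))
  (λ f → trans (⊠-at-0 𝟘 f) (ℚP.*-zeroˡ (f 0 0 0))) f

⊠-identityˡ : ∀ f → 𝟙 ⊠ f ≈ f
⊠-identityˡ f = taylor {Ser3} (𝟙 ⊠_) id (λ v f → ∂ v f ∷ [])
  (λ v f → ≈-trans (∂-⊠ v 𝟙 f) (≈-trans
    (⊞-cong (≈-trans (⊠-cong (∂-𝟙 v) ≈-refl) (⊠-zeroˡ f)) ≈-refl) (⊞-comm _ _)))
  (λ v f → ≈-sym (⊞-identityʳ (∂ v f)))
  (λ f → trans (⊠-at-0 𝟙 f) (ℚP.*-identityˡ (f 0 0 0))) f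

⊠-identityʳ : ∀ f → f ⊠ 𝟙 ≈ f
⊠-identityʳ f = ≈-trans (⊠-comm f 𝟙) (⊠-identityˡ f)

≈-isEquivalence : IsEquivalence _≈_
≈-isEquivalence = record { refl = ≈-refl ; sym = ≈-sym ; trans = ≈-trans }

opaque
  unfolding _⊞_

  ⊞-inverseˡ : ∀ f → ⊟ f ⊞ f ≈ 𝟘
  ⊞-inverseˡ f .at i j l = ℚP.+-inverseˡ (f i j l)

  ⊞-inverseʳ : ∀ f → f ⊞ ⊟ f ≈ 𝟘
  ⊞-inverseʳ f .at i j l = ℚP.+-inverseʳ (f i j l)

Ser3-commutativeRing : CommutativeRing 0ℓ 0ℓ
Ser3-commutativeRing = record
  { Carrier = Ser3
  ; _≈_ = _≈_
  ; _+_ = _⊞_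
  ; _*_ = _⊠_
  ; -_ = ⊟_
  ; 0# = 𝟘
  ; 1# = 𝟙
  ; isCommutativeRing = record
    { isRing = record
      { +-isAbelianGroup = record
        { isGroup = record
          { isMonoid = record
            { isSemigroup = record
              { isMagma = record { isEquivalence = ≈-isEquivalence ; ∙-cong = ⊞-cong }
              ; assoc = ⊞-assoc
              }
            ; identity = ⊞-identityˡ , ⊞-identityʳ
            }
          ; inverse = ⊞-inverseˡ , ⊞-inverseʳ
          ; ⁻¹-cong = ⊟-cong
          }
        ; comm = ⊞-comm
        }
      ; *-cong = ⊠-cong
      ; *-assoc = ⊠-assoc
      ; *-identity = ⊠-identityˡ , ⊠-identityʳ
      ; distrib = ⊠-distribˡ , ⊠-distribʳ
      }
    ; *-comm = ⊠-comm
    }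
  }

-- Univariate series and substitution

D : Ser1 → Ser1
D f n = ℕ→ℚ (suc n) * f (suc n)

_+₁_ : Ser1 → Ser1 → Ser1
(f +₁ g) n = f n + g n

neg₁ : Ser1 → Ser1
neg₁ f n = - f n

one₁ : Ser1
one₁ zero    = 1ℚ
one₁ (suc n) = 0ℚ

D-*₁ : ∀ f g → D (f *₁ g) ≗ (D f *₁ g) +₁ (f *₁ D g)
D-*₁ f g n = trans (sumTo-leibniz n (λ a a′ → f a * g a′)) (cong₂ _+_
  (sumTo-cong n λ a → sym (ℚP.*-assoc (ℕ→ℚ (suc a)) (f (suc a)) (g (n ∸ a))))
  (sumTo-cong n λ a → x*yz≡y*xz (ℕ→ℚ (suc (n ∸ a))) (f a) (g (suc (n ∸ a)))))

sinSgn-suc : ∀ n → sinSgn (suc n) ≡ cosSgn n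
sinSgn-suc 0 = refl
sinSgn-suc 1 = refl
sinSgn-suc 2 = refl
sinSgn-suc 3 = refl
sinSgn-suc (suc (suc (suc (suc n)))) = sinSgn-suc n

cosSgn-suc : ∀ n → cosSgn (suc n) ≡ ℤ.- sinSgn n
cosSgn-suc 0 = refl
cosSgn-suc 1 = refl
cosSgn-suc 2 = refl
cosSgn-suc 3 = refl
cosSgn-suc (suc (suc (suc (suc n)))) = cosSgn-suc n

/1-neg : ∀ p → (ℤ.- p) / 1 ≡ - (p / 1)
/1-neg p = inverseˡ-unique ((ℤ.- p) / 1) (p / 1)
  (trans (sym (/1-+ (ℤ.- p) p)) (cong (_/ 1) (ℤP.+-inverseˡ p)))

D-egf : ∀ (c : ℕ → ℤ) n → ℕ→ℚ (suc n) * (c (suc n) / 1 * invFact (suc n)) ≡ c (suc n) / 1 * invFact n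
D-egf c n = trans (x*yz≡y*xz (ℕ→ℚ (suc n)) (c (suc n) / 1) (invFact (suc n)))
  (cong (c (suc n) / 1 *_) (suc-invFact n))

D-sin : D sinS ≗ cosS
D-sin n = trans (D-egf sinSgn n) (cong (λ z → z / 1 * invFact n) (sinSgn-suc n))

D-cos : D cosS ≗ neg₁ sinS
D-cos n = trans (D-egf cosSgn n) (trans
  (cong (_* invFact n) (trans (cong (_/ 1) (cosSgn-suc n)) (/1-neg (sinSgn n))))
  (sym (ℚP.neg-distribˡ-* (sinSgn n / 1) (invFact n))))

-- Turns the list recursion of the reciprocal into a convolution. The index map `k` is general
-- because the tail of `applyUpTo k` is generated by `k ∘ suc`.
recipRev-dot : ∀ f n (h : ℕ → ℚ) (k : ℕ → ℕ) →
  sumℚ (zipWith _*_ (map h (applyUpTo k (suc n))) (recipRev f n))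
  ≡ sumTo n (λ a → h (k a) * recip₁ f (n ∸ a))
recipRev-dot f zero    h k = ℚP.+-identityʳ (h (k 0) * 1ℚ)
recipRev-dot f (suc n) h k = trans
  (cong (λ q → h (k 0) * recip₁ f (suc n) + q) (recipRev-dot f n h (k ∘ suc)))
  (sym (sumTo-shift n (λ a → h (k a) * recip₁ f (suc n ∸ a))))

-- Each new coefficient of the reciprocal is chosen as minus the remaining terms of the convolution,
-- so everything of positive degree cancels.
*₁-inverseʳ : ∀ f → f 0 ≡ 1ℚ → f *₁ recip₁ f ≗ one₁
*₁-inverseʳ f f₀ zero    = trans (ℚP.*-identityʳ (f 0)) f₀
*₁-inverseʳ f f₀ (suc n) = begin
  sumTo (suc n) (λ a → f a * recip₁ f (suc n ∸ a))  ≡⟨ sumTo-shift n (λ a → f a * recip₁ f (suc n ∸ a)) ⟩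
  f 0 * (- s) + t                                   ≡⟨ cong₂ _+_ (trans (cong (_* (- s)) f₀) (ℚP.*-identityˡ (- s))) (sym (recipRev-dot f n (f ∘ suc) id)) ⟩
  - s + s                                           ≡⟨ ℚP.+-inverseˡ s ⟩
  0ℚ                                                ∎
  where
  open ≡-Reasoning
  s t : ℚ
  s = sumℚ (zipWith _*_ (map (λ k → f (suc k)) (upTo (suc n))) (recipRev f n))
  t = sumTo n (λ a → f (suc a) * recip₁ f (n ∸ a))

atX-cong : ∀ {f g} → f ≗ g → atX f ≈ atX g
atX-cong p .at i zero    zero    = p i
atX-cong p .at i zero    (suc l) = refl
atX-cong p .at i (suc j) l       = refl

atZ-cong : ∀ {f g} → f ≗ g → atZ f ≈ atZ g
atZ-cong p .at zero    zero    l = p l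
atZ-cong p .at zero    (suc j) l = refl
atZ-cong p .at (suc i) j       l = refl

atXYZ-cong : ∀ {f g} → f ≗ g → atXYZ f ≈ atXYZ g
atXYZ-cong p .at i j l =
  cong (λ q → q * ℕ→ℚ ((i ℕ.+ j ℕ.+ l) !) * invFact i * invFact j * invFact l) (p (i ℕ.+ j ℕ.+ l))

opaque
  unfolding _⊞_ ∂

  atX-neg : ∀ f → atX (neg₁ f) ≈ ⊟ atX f
  atX-neg f .at i zero    zero    = refl
  atX-neg f .at i zero    (suc l) = refl
  atX-neg f .at i (suc j) l       = refl

  atZ-neg : ∀ f → atZ (neg₁ f) ≈ ⊟ atZ f
  atZ-neg f .at zero    zero    l = refl
  atZ-neg f .at zero    (suc j) l = refl
  atZ-neg f .at (suc i) j       l = refl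

  atXYZ-neg : ∀ f → atXYZ (neg₁ f) ≈ ⊟ atXYZ f
  atXYZ-neg f .at i j l =
    solve 5 (λ p g u v w → (:- p) :* g :* u :* v :* w := :- (p :* g :* u :* v :* w)) refl
      (f (i ℕ.+ j ℕ.+ l)) (ℕ→ℚ ((i ℕ.+ j ℕ.+ l) !)) (invFact i) (invFact j) (invFact l)
    where open +-*-Solver

  atXYZ-+ : ∀ f g → atXYZ (f +₁ g) ≈ atXYZ f ⊞ atXYZ g
  atXYZ-+ f g .at i j l =
    solve 6 (λ p q g u v w → (p :+ q) :* g :* u :* v :* w := p :* g :* u :* v :* w :+ q :* g :* u :* v :* w) refl
      (f (i ℕ.+ j ℕ.+ l)) (g (i ℕ.+ j ℕ.+ l)) (ℕ→ℚ ((i ℕ.+ j ℕ.+ l) !)) (invFact i) (invFact j) (invFact l)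
    where open +-*-Solver

  ∂X-atX : ∀ f → ∂ X (atX f) ≈ atX (D f)
  ∂X-atX f .at i zero    zero    = refl
  ∂X-atX f .at i zero    (suc l) = ℚP.*-zeroʳ (ℕ→ℚ (suc i))
  ∂X-atX f .at i (suc j) l       = ℚP.*-zeroʳ (ℕ→ℚ (suc i))

  ∂Y-atX : ∀ f → ∂ Y (atX f) ≈ 𝟘
  ∂Y-atX f .at i j l = ℚP.*-zeroʳ (ℕ→ℚ (suc j))

  ∂Z-atZ : ∀ f → ∂ Z (atZ f) ≈ atZ (D f)
  ∂Z-atZ f .at zero    zero    l = refl
  ∂Z-atZ f .at zero    (suc j) l = ℚP.*-zeroʳ (ℕ→ℚ (suc l))
  ∂Z-atZ f .at (suc i) j       l = ℚP.*-zeroʳ (ℕ→ℚ (suc l))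

  ∂X-atZ : ∀ f → ∂ X (atZ f) ≈ 𝟘
  ∂X-atZ f .at i j l = ℚP.*-zeroʳ (ℕ→ℚ (suc i))

  ∂Y-atZ : ∀ f → ∂ Y (atZ f) ≈ 𝟘
  ∂Y-atZ f .at zero    j l = ℚP.*-zeroʳ (ℕ→ℚ (suc j))
  ∂Y-atZ f .at (suc i) j l = ℚP.*-zeroʳ (ℕ→ℚ (suc j))

  private
    !-suc : ∀ N → ℕ→ℚ (suc N !) ≡ ℕ→ℚ (suc N) * ℕ→ℚ (N !)
    !-suc N = ℕ→ℚ-* (suc N) (N !)

    -- The chain rule on coefficients: the factor N+1 of (N+1)! turns `f (suc N)` into `D f N`, and
    -- the factor i+1 cancels against 1/(i+1)!.
    scale₁ : ∀ (f : Ser1) N i v w →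
      ℕ→ℚ (suc i) * (f (suc N) * ℕ→ℚ (suc N !) * invFact (suc i) * v * w)
      ≡ D f N * ℕ→ℚ (N !) * invFact i * v * w
    scale₁ f N i v w = trans (cong (λ q → ℕ→ℚ (suc i) * (f (suc N) * q * invFact (suc i) * v * w)) (!-suc N))
      (trans
        (solve 7 (λ s p n g u v w → s :* (p :* (n :* g) :* u :* v :* w) := (n :* p) :* g :* (s :* u) :* v :* w) refl
          (ℕ→ℚ (suc i)) (f (suc N)) (ℕ→ℚ (suc N)) (ℕ→ℚ (N !)) (invFact (suc i)) v w)
        (cong (λ q → D f N * ℕ→ℚ (N !) * q * v * w) (suc-invFact i)))
      where open +-*-Solver

    swap₁₂ : ∀ p g u v w → p * g * u * v * w ≡ p * g * v * u * w
    swap₁₂ = solve 5 (λ p g u v w → p :* g :* u :* v :* w := p :* g :* v :* u :* w) refl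
      where open +-*-Solver

    swap₁₃ : ∀ p g u v w → p * g * u * v * w ≡ p * g * w * v * u
    swap₁₃ = solve 5 (λ p g u v w → p :* g :* u :* v :* w := p :* g :* w :* v :* u) refl
      where open +-*-Solver

  ∂-atXYZ : ∀ v f → ∂ v (atXYZ f) ≈ atXYZ (D f)
  ∂-atXYZ X f .at i j l = scale₁ f (i ℕ.+ j ℕ.+ l) i (invFact j) (invFact l)
  ∂-atXYZ Y f .at i j l rewrite ℕP.+-suc i j = trans
    (cong (ℕ→ℚ (suc j) *_) (swap₁₂ (f (suc (i ℕ.+ j ℕ.+ l))) (ℕ→ℚ (suc (i ℕ.+ j ℕ.+ l) !)) (invFact i) (invFact (suc j)) (invFact l)))
    (trans (scale₁ f (i ℕ.+ j ℕ.+ l) j (invFact i) (invFact l))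
      (swap₁₂ (D f (i ℕ.+ j ℕ.+ l)) (ℕ→ℚ ((i ℕ.+ j ℕ.+ l) !)) (invFact j) (invFact i) (invFact l)))
  ∂-atXYZ Z f .at i j l rewrite ℕP.+-suc (i ℕ.+ j) l = trans
    (cong (ℕ→ℚ (suc l) *_) (swap₁₃ (f (suc (i ℕ.+ j ℕ.+ l))) (ℕ→ℚ (suc (i ℕ.+ j ℕ.+ l) !)) (invFact i) (invFact j) (invFact (suc l))))
    (trans (scale₁ f (i ℕ.+ j ℕ.+ l) l (invFact j) (invFact i))
      (swap₁₃ (D f (i ℕ.+ j ℕ.+ l)) (ℕ→ℚ ((i ℕ.+ j ℕ.+ l) !)) (invFact l) (invFact j) (invFact i)))

  atXY≡atXYZ : ∀ f i j → atXY f i j 0 ≡ atXYZ f i j 0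
  atXY≡atXYZ f i j rewrite ℕP.+-identityʳ (i ℕ.+ j) = sym (ℚP.*-identityʳ _)

  ∂X-atXY : ∀ f → ∂ X (atXY f) ≈ ∂ Y (atXY f)
  ∂X-atXY f .at i j zero = begin
    ℕ→ℚ (suc i) * atXY f (suc i) j 0   ≡⟨ cong (ℕ→ℚ (suc i) *_) (atXY≡atXYZ f (suc i) j) ⟩
    ℕ→ℚ (suc i) * atXYZ f (suc i) j 0  ≡⟨ at (∂-atXYZ X f) i j 0 ⟩
    atXYZ (D f) i j 0                  ≡⟨ at (∂-atXYZ Y f) i j 0 ⟨
    ℕ→ℚ (suc j) * atXYZ f i (suc j) 0  ≡⟨ cong (ℕ→ℚ (suc j) *_) (atXY≡atXYZ f i (suc j)) ⟨
    ℕ→ℚ (suc j) * atXY f i (suc j) 0   ∎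
    where open ≡-Reasoning
  ∂X-atXY f .at i j (suc l) = trans (ℚP.*-zeroʳ (ℕ→ℚ (suc i))) (sym (ℚP.*-zeroʳ (ℕ→ℚ (suc j))))

  ∂Z-atXY : ∀ f → ∂ Z (atXY f) ≈ 𝟘
  ∂Z-atXY f .at i j l = ℚP.*-zeroʳ (ℕ→ℚ (suc l))

atXYZ-0 : ∀ f → atXYZ f 0 0 0 ≡ f 0
atXYZ-0 f = solve 1 (λ p → p :* con 1ℚ :* con 1ℚ :* con 1ℚ :* con 1ℚ := p) refl (f 0)
  where open +-*-Solver

-- By coefficients this would be a Vandermonde convolution of multinomials. Both sides obey the same
-- product rule in `f` and `g`, so `taylor` over all pairs suffices.
atXYZ-* : ∀ f g → atXYZ (f *₁ g) ≈ atXYZ f ⊠ atXYZ g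
atXYZ-* f g = taylor {Ser1 × Ser1} (λ (f , g) → atXYZ (f *₁ g)) (λ (f , g) → atXYZ f ⊠ atXYZ g)
  (λ v (f , g) → (D f , g) ∷ (f , D g) ∷ [])
  (λ v (f , g) → ≈-trans (∂-atXYZ v (f *₁ g)) (≈-trans (atXYZ-cong (D-*₁ f g))
    (≈-trans (atXYZ-+ (D f *₁ g) (f *₁ D g)) (⊞-cong ≈-refl (≈-sym (⊞-identityʳ _))))))
  (λ v (f , g) → ≈-trans (∂-⊠ v (atXYZ f) (atXYZ g)) (⊞-cong
    (⊠-cong (∂-atXYZ v f) ≈-refl)
    (≈-trans (⊠-cong ≈-refl (∂-atXYZ v g)) (≈-sym (⊞-identityʳ _)))))
  (λ (f , g) → trans (atXYZ-0 (f *₁ g))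
    (sym (trans (⊠-at-0 (atXYZ f) (atXYZ g)) (cong₂ _*_ (atXYZ-0 f) (atXYZ-0 g)))))
  (f , g)

atXYZ-one : atXYZ one₁ ≈ 𝟙
atXYZ-one .at = λ where
    zero    zero    zero    → refl
    zero    zero    (suc l) → vanish (suc l) 0 0 (suc l)
    zero    (suc j) l       → vanish (suc (j ℕ.+ l)) 0 (suc j) l
    (suc i) j       l       → vanish (suc (i ℕ.+ j ℕ.+ l)) (suc i) j l
  where
  open +-*-Solver
  vanish : ∀ N i j l → 0ℚ * ℕ→ℚ (N !) * invFact i * invFact j * invFact l ≡ 0ℚ
  vanish N i j l = solve 4 (λ g u v w → con 0ℚ :* g :* u :* v :* w := con 0ℚ) refl
    (ℕ→ℚ (N !)) (invFact i) (invFact j) (invFact l)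

atXYZ-inverseʳ : ∀ f → f 0 ≡ 1ℚ → atXYZ f ⊠ atXYZ (recip₁ f) ≈ 𝟙
atXYZ-inverseʳ f f₀ = ≈-trans (≈-sym (atXYZ-* f (recip₁ f)))
  (≈-trans (atXYZ-cong (*₁-inverseʳ f f₀)) atXYZ-one)

-- Congruence of series on a down-closed set of monomials

-- Agreement on such a set is equality modulo the ideal of series supported outside it. A
-- coefficient of a product involves only smaller exponents, so `down` is what makes multiplication
-- well defined on the quotient.
record Region : Set₁ where
  field
    holds : ℕ → ℕ → ℕ → Set
    down  : ∀ {i j l a b c} → a ≤ i → b ≤ j → c ≤ l → holds i j l → holds a b c

open Region

exponent : Var → ℕ → ℕ → ℕ → ℕ
exponent X i j l = i
exponent Y i j l = j
exponent Z i j l = l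

exponent-mono : ∀ v {i j l a b c} → a ≤ i → b ≤ j → c ≤ l → exponent v a b c ≤ exponent v i j l
exponent-mono X p q r = p
exponent-mono Y p q r = q
exponent-mono Z p q r = r

everywhere : Region
everywhere .holds _ _ _ = ⊤
everywhere .down _ _ _ _ = tt

infixl 6 _∩_=0

_∩_=0 : Region → Var → Region
(R ∩ v =0) .holds i j l = holds R i j l × exponent v i j l ≡ 0
(R ∩ v =0) .down p q r (h , e) =
  down R p q r h , ℕP.n≤0⇒n≡0 (subst (_ ≤_) e (exponent-mono v p q r))

infix 4 _≈[_]_

record _≈[_]_ (f : Ser3) (R : Region) (g : Ser3) : Set where
  constructor mk
  field at[] : ∀ i j l → holds R i j l → f i j l ≡ g i j l

open _≈[_]_

on : ∀ {R f g} → f ≈ g → f ≈[ R ] g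
on p .at[] i j l _ = at p i j l

restrict : ∀ {R v f g} → f ≈[ R ] g → f ≈[ R ∩ v =0 ] g
restrict p .at[] i j l (h , _) = at[] p i j l h

opaque
  unfolding _⊞_ ∂

  ⊞-cong[] : ∀ {R f f′ g g′} → f ≈[ R ] f′ → g ≈[ R ] g′ → f ⊞ g ≈[ R ] f′ ⊞ g′
  ⊞-cong[] p q .at[] i j l h = cong₂ _+_ (at[] p i j l h) (at[] q i j l h)

  ⊟-cong[] : ∀ {R f g} → f ≈[ R ] g → ⊟ f ≈[ R ] ⊟ g
  ⊟-cong[] p .at[] i j l h = cong -_ (at[] p i j l h)

  ⊠-cong[] : ∀ {R f f′ g g′} → f ≈[ R ] f′ → g ≈[ R ] g′ → f ⊠ g ≈[ R ] f′ ⊠ g′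
  ⊠-cong[] {R} p q .at[] i j l h =
    sumTo-cong≤ i λ a a≤i → sumTo-cong≤ j λ b b≤j → sumTo-cong≤ l λ c c≤l → cong₂ _*_
      (at[] p a b c (down R a≤i b≤j c≤l h))
      (at[] q (i ∸ a) (j ∸ b) (l ∸ c) (down R (ℕP.m∸n≤m i a) (ℕP.m∸n≤m j b) (ℕP.m∸n≤m l c) h))

  -- Differentiation looks one exponent further and so need not respect a region; here it does,
  -- because x = 0 puts no bound on the exponent of z.
  ∂Z-cong[X=0] : ∀ {f g} → f ≈[ everywhere ∩ X =0 ] g → ∂ Z f ≈[ everywhere ∩ X =0 ] ∂ Z g
  ∂Z-cong[X=0] p .at[] i j l h = cong (ℕ→ℚ (suc l) *_) (at[] p i j (suc l) h)

  -- A positive power of `v` is recovered from the derivative one step lower, which is still in `R`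
  -- by `down`; the face supplies the power zero.
  integrate : ∀ v {R f g} → ∂ v f ≈[ R ] ∂ v g → f ≈[ R ∩ v =0 ] g → f ≈[ R ] g
  integrate X {R} d b .at[] zero    j l h = at[] b zero j l (h , refl)
  integrate X {R} d b .at[] (suc i) j l h =
    suc-cancel i (at[] d i j l (down R (ℕP.n≤1+n i) ℕP.≤-refl ℕP.≤-refl h))
  integrate Y {R} d b .at[] i zero    l h = at[] b i zero l (h , refl)
  integrate Y {R} d b .at[] i (suc j) l h =
    suc-cancel j (at[] d i j l (down R ℕP.≤-refl (ℕP.n≤1+n j) ℕP.≤-refl h))
  integrate Z {R} d b .at[] i j zero    h = at[] b i j zero (h , refl)
  integrate Z {R} d b .at[] i j (suc l) h =
    suc-cancel l (at[] d i j l (down R ℕP.≤-refl ℕP.≤-refl (ℕP.n≤1+n l) h))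

Ser3/ : Region → CommutativeRing 0ℓ 0ℓ
Ser3/ R = record
  { Carrier = Ser3
  ; _≈_ = _≈[ R ]_
  ; _+_ = _⊞_
  ; _*_ = _⊠_
  ; -_ = ⊟_
  ; 0# = 𝟘
  ; 1# = 𝟙
  ; isCommutativeRing = record
    { isRing = record
      { +-isAbelianGroup = record
        { isGroup = record
          { isMonoid = record
            { isSemigroup = record
              { isMagma = record
                { isEquivalence = record
                  { refl = on ≈-refl
                  ; sym = λ p → mk λ i j l h → sym (at[] p i j l h)
                  ; trans = λ p q → mk λ i j l h → trans (at[] p i j l h) (at[] q i j l h)
                  }
                ; ∙-cong = ⊞-cong[]
                }
              ; assoc = λ f g h → on (⊞-assoc f g h)
              }
            ; identity = (λ f → on (⊞-identityˡ f)) , (λ f → on (⊞-identityʳ f))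
            }
          ; inverse = (λ f → on (⊞-inverseˡ f)) , (λ f → on (⊞-inverseʳ f))
          ; ⁻¹-cong = ⊟-cong[]
          }
        ; comm = λ f g → on (⊞-comm f g)
        }
      ; *-cong = ⊠-cong[]
      ; *-assoc = λ f g h → on (⊠-assoc f g h)
      ; *-identity = (λ f → on (⊠-identityˡ f)) , (λ f → on (⊠-identityʳ f))
      ; distrib = (λ f g h → on (⊠-distribˡ f g h)) , (λ f g h → on (⊠-distribʳ f g h))
      }
    ; *-comm = λ f g → on (⊠-comm f g)
    }
  }

module Series = CommutativeRing Ser3-commutativeRing

module Modulo (R : Region) where
  open CommutativeRing (Ser3/ R) public using (setoid; commutativeSemiring) renaming (refl to ≋-refl; sym to ≋-sym)
  open SetoidReasoning setoid public
  open SemiringSolver commutativeSemiring public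

module ≈-Reasoning = SetoidReasoning Series.setoid

-- Trigonometric series

sinX cosX sinZ cosZ cosXY sinXYZ cosXYZ secXYZ sec²XYZ : Ser3
sinX    = atX sinS
cosX    = atX cosS
sinZ    = atZ sinS
cosZ    = atZ cosS
cosXY   = atXY cosS
sinXYZ  = atXYZ sinS
cosXYZ  = atXYZ cosS
secXYZ  = atXYZ (recip₁ cosS)
sec²XYZ = atXYZ (recip₁ (cosS *₁ cosS))

⊞-⊟-vanish : ∀ {f g} → f ≈ ⊟ g → f ⊞ g ≈ 𝟘
⊞-⊟-vanish {g = g} p = ≈-trans (⊞-cong p ≈-refl) (⊞-inverseˡ g)

∂X-sinX : ∂ X sinX ≈ cosX
∂X-sinX = ≈-trans (∂X-atX sinS) (atX-cong D-sin)

∂X-cosX : ∂ X cosX ≈ ⊟ sinX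
∂X-cosX = ≈-trans (∂X-atX cosS) (≈-trans (atX-cong D-cos) (atX-neg sinS))

∂Z-sinZ : ∂ Z sinZ ≈ cosZ
∂Z-sinZ = ≈-trans (∂Z-atZ sinS) (atZ-cong D-sin)

∂Z-cosZ : ∂ Z cosZ ≈ ⊟ sinZ
∂Z-cosZ = ≈-trans (∂Z-atZ cosS) (≈-trans (atZ-cong D-cos) (atZ-neg sinS))

∂-sinXYZ : ∀ v → ∂ v sinXYZ ≈ cosXYZ
∂-sinXYZ v = ≈-trans (∂-atXYZ v sinS) (atXYZ-cong D-sin)

∂-cosXYZ : ∀ v → ∂ v cosXYZ ≈ ⊟ sinXYZ
∂-cosXYZ v = ≈-trans (∂-atXYZ v cosS) (≈-trans (atXYZ-cong D-cos) (atXYZ-neg sinS))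

-- The vectors (c, s) and (x, y) rotate at the same speed, so their inner product is constant. This
-- gives the Pythagorean identity and the subtraction formulas for the cosine.
∂-rotation : ∀ v {c s x y} → ∂ v c ≈ ⊟ s → ∂ v s ≈ c → ∂ v x ≈ ⊟ y → ∂ v y ≈ x →
  ∂ v (c ⊠ x ⊞ s ⊠ y) ≈ 𝟘
∂-rotation v {c} {s} {x} {y} c′ s′ x′ y′ = begin
  ∂ v (c ⊠ x ⊞ s ⊠ y)                                     ≈⟨ ∂-⊞ v (c ⊠ x) (s ⊠ y) ⟩
  ∂ v (c ⊠ x) ⊞ ∂ v (s ⊠ y)                               ≈⟨ ⊞-cong (∂-⊠ v c x) (∂-⊠ v s y) ⟩
  (∂ v c ⊠ x ⊞ c ⊠ ∂ v x) ⊞ (∂ v s ⊠ y ⊞ s ⊠ ∂ v y)       ≈⟨ ⊞-cong ≈-refl (⊞-cong (⊠-cong s′ ≈-refl) (⊠-cong ≈-refl y′)) ⟩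
  (∂ v c ⊠ x ⊞ c ⊠ ∂ v x) ⊞ (c ⊠ y ⊞ s ⊠ x)               ≈⟨ vanishing-sum x c (⊞-⊟-vanish c′) (⊞-⊟-vanish x′) ⟩
  𝟘                                                       ∎
  where
  open ≈-Reasoning
  open Algebraic Ser3-commutativeRing

sinX-face : ∀ {R} → sinX ≈[ R ∩ X =0 ] 𝟘
sinX-face .at[] zero zero    zero    (_ , refl) = refl
sinX-face .at[] zero zero    (suc l) (_ , refl) = refl
sinX-face .at[] zero (suc j) l       (_ , refl) = refl

cosX-face : ∀ {R} → cosX ≈[ R ∩ X =0 ] 𝟙
cosX-face .at[] zero zero    zero    (_ , refl) = refl
cosX-face .at[] zero zero    (suc l) (_ , refl) = refl
cosX-face .at[] zero (suc j) l       (_ , refl) = refl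

sinZ-face : ∀ {R} → sinZ ≈[ R ∩ Z =0 ] 𝟘
sinZ-face .at[] zero    zero    zero (_ , refl) = refl
sinZ-face .at[] zero    (suc j) zero (_ , refl) = refl
sinZ-face .at[] (suc i) j       zero (_ , refl) = refl

cosZ-face : ∀ {R} → cosZ ≈[ R ∩ Z =0 ] 𝟙
cosZ-face .at[] zero    zero    zero (_ , refl) = refl
cosZ-face .at[] zero    (suc j) zero (_ , refl) = refl
cosZ-face .at[] (suc i) j       zero (_ , refl) = refl

cosXYZ-face : ∀ {R} → cosXYZ ≈[ R ∩ Z =0 ] cosXY
cosXYZ-face .at[] i j zero (_ , refl) = sym (atXY≡atXYZ cosS i j)

atXYZ-edge : ∀ f → atXYZ f ≈[ everywhere ∩ Y =0 ∩ X =0 ] atZ f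
atXYZ-edge f .at[] zero zero l ((_ , refl) , refl) = begin
  f l * ℕ→ℚ (l !) * 1ℚ * 1ℚ * invFact l  ≡⟨ solve 3 (λ p g w → p :* g :* con 1ℚ :* con 1ℚ :* w := p :* (g :* w)) refl (f l) (ℕ→ℚ (l !)) (invFact l) ⟩
  f l * (ℕ→ℚ (l !) * invFact l)          ≡⟨ cong (f l *_) (!-invFact l) ⟩
  f l * 1ℚ                               ≡⟨ ℚP.*-identityʳ (f l) ⟩
  f l                                    ∎
  where
  open ≡-Reasoning
  open +-*-Solver

pythagoras : cosX ⊠ cosX ⊞ sinX ⊠ sinX ≈[ everywhere ] 𝟙
pythagoras = integrate X
  (on (≈-trans (∂-rotation X ∂X-cosX ∂X-sinX ∂X-cosX ∂X-sinX) (≈-sym (∂-𝟙 X))))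
  (begin
    cosX ⊠ cosX ⊞ sinX ⊠ sinX  ≈⟨ ⊞-cong[] (⊠-cong[] cosX-face cosX-face) (⊠-cong[] sinX-face sinX-face) ⟩
    𝟙 ⊠ 𝟙 ⊞ 𝟘 ⊠ 𝟘              ≈⟨ solve 0 (con 1 :* con 1 :+ con 0 :* con 0 := con 1) ≋-refl ⟩
    𝟙                          ∎)
  where
  open Modulo (everywhere ∩ X =0)

-- On y = 0 the difference (x + y + z) - x is z; the left side is constant in x and can be evaluated
-- at x = 0.
cos-sub : cosXYZ ⊠ cosX ⊞ sinXYZ ⊠ sinX ≈[ everywhere ∩ Y =0 ] cosZ
cos-sub = integrate X
  (on (≈-trans (∂-rotation X (∂-cosXYZ X) (∂-sinXYZ X) ∂X-cosX ∂X-sinX) (≈-sym (∂X-atZ cosS))))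
  (begin
    cosXYZ ⊠ cosX ⊞ sinXYZ ⊠ sinX  ≈⟨ ⊞-cong[] (⊠-cong[] ≋-refl cosX-face) (⊠-cong[] ≋-refl sinX-face) ⟩
    cosXYZ ⊠ 𝟙 ⊞ sinXYZ ⊠ 𝟘        ≈⟨ solve 2 (λ c s → c :* con 1 :+ s :* con 0 := c) ≋-refl cosXYZ sinXYZ ⟩
    cosXYZ                         ≈⟨ atXYZ-edge cosS ⟩
    cosZ                           ∎)
  where
  open Modulo (everywhere ∩ Y =0 ∩ X =0)

∂X-sin-sub : ∂ X (cosX ⊠ sinXYZ) ≈ ∂ X (sinX ⊠ cosXYZ ⊞ sinZ)
∂X-sin-sub = begin
  ∂ X (cosX ⊠ sinXYZ)                         ≈⟨ ∂-⊠ X cosX sinXYZ ⟩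
  ∂ X cosX ⊠ sinXYZ ⊞ cosX ⊠ ∂ X sinXYZ       ≈⟨ ⊞-cong (⊠-cong ∂X-cosX ≈-refl) (⊠-cong ≈-refl (∂-sinXYZ X)) ⟩
  ⊟ sinX ⊠ sinXYZ ⊞ cosX ⊠ cosXYZ             ≈⟨ ⊞-comm (⊟ sinX ⊠ sinXYZ) (cosX ⊠ cosXYZ) ⟩
  cosX ⊠ cosXYZ ⊞ ⊟ sinX ⊠ sinXYZ             ≈⟨ ⊞-cong ≈-refl (≈-trans (≈-sym (-‿distribˡ-* sinX sinXYZ)) (-‿distribʳ-* sinX sinXYZ)) ⟩
  cosX ⊠ cosXYZ ⊞ sinX ⊠ ⊟ sinXYZ             ≈⟨ ⊞-cong (⊠-cong ∂X-sinX ≈-refl) (⊠-cong ≈-refl (∂-cosXYZ X)) ⟨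
  ∂ X sinX ⊠ cosXYZ ⊞ sinX ⊠ ∂ X cosXYZ       ≈⟨ ∂-⊠ X sinX cosXYZ ⟨
  ∂ X (sinX ⊠ cosXYZ)                         ≈⟨ ⊞-identityʳ (∂ X (sinX ⊠ cosXYZ)) ⟨
  ∂ X (sinX ⊠ cosXYZ) ⊞ 𝟘                     ≈⟨ ⊞-cong ≈-refl (∂X-atZ sinS) ⟨
  ∂ X (sinX ⊠ cosXYZ) ⊞ ∂ X sinZ              ≈⟨ ∂-⊞ X (sinX ⊠ cosXYZ) sinZ ⟨
  ∂ X (sinX ⊠ cosXYZ ⊞ sinZ)                  ∎
  where
  open ≈-Reasoning
  open RingProperties Series.ring using (-‿distribˡ-*; -‿distribʳ-*)

-- On y = 0 this is sin(s - x) = sin z, s = x + y + z, with the subtracted product moved to the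
-- right.
sin-sub : cosX ⊠ sinXYZ ≈[ everywhere ∩ Y =0 ] sinX ⊠ cosXYZ ⊞ sinZ
sin-sub = integrate X (on ∂X-sin-sub)
  (begin
    cosX ⊠ sinXYZ           ≈⟨ ⊠-cong[] cosX-face ≋-refl ⟩
    𝟙 ⊠ sinXYZ              ≈⟨ on (⊠-identityˡ sinXYZ) ⟩
    sinXYZ                  ≈⟨ atXYZ-edge sinS ⟩
    sinZ                    ≈⟨ solve 2 (λ c s → s := con 0 :* c :+ s) ≋-refl cosXYZ sinZ ⟩
    𝟘 ⊠ cosXYZ ⊞ sinZ       ≈⟨ ⊞-cong[] (⊠-cong[] sinX-face ≋-refl) ≋-refl ⟨
    sinX ⊠ cosXYZ ⊞ sinZ    ∎)
  where
  open Modulo (everywhere ∩ Y =0 ∩ X =0)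

cosXY-expand : cosZ ⊠ cosXYZ ⊞ sinZ ⊠ sinXYZ ≈[ everywhere ] cosXY
cosXY-expand = integrate Z
  (on (≈-trans (∂-rotation Z ∂Z-cosZ ∂Z-sinZ (∂-cosXYZ Z) (∂-sinXYZ Z)) (≈-sym (∂Z-atXY cosS))))
  (begin
    cosZ ⊠ cosXYZ ⊞ sinZ ⊠ sinXYZ  ≈⟨ ⊞-cong[] (⊠-cong[] cosZ-face ≋-refl) (⊠-cong[] sinZ-face ≋-refl) ⟩
    𝟙 ⊠ cosXYZ ⊞ 𝟘 ⊠ sinXYZ        ≈⟨ solve 2 (λ c s → con 1 :* c :+ con 0 :* s := c) ≋-refl cosXYZ sinXYZ ⟩
    cosXYZ                         ≈⟨ cosXYZ-face ⟩
    cosXY                          ∎)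
  where
  open Modulo (everywhere ∩ Z =0)

secant : cosXYZ ⊠ secXYZ ≈ 𝟙
secant = atXYZ-inverseʳ cosS refl

secant² : sec²XYZ ≈ secXYZ ⊠ secXYZ
secant² = Algebraic.secant-squared Ser3-commutativeRing secant
  (≈-trans (⊠-cong (≈-sym (atXYZ-* cosS cosS)) ≈-refl) (atXYZ-inverseʳ (cosS *₁ cosS) refl))

∂Z-secXYZ : ∂ Z secXYZ ≈ secXYZ ⊠ secXYZ ⊠ sinXYZ
∂Z-secXYZ = Algebraic.secant-derivative Ser3-commutativeRing secant (⊞-⊟-vanish (∂-cosXYZ Z))
  (≈-trans (≈-sym (∂-⊠ Z cosXYZ secXYZ)) (≈-trans (∂-cong Z secant) (∂-𝟙 Z)))

-- The system of differential equations

-- Exchanges x and z. In order i+l+3 the entry at (i+1, i+2) carries x^i z^l in the upper series,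
-- while its mirror image at (i+2, i+1) carries x^l z^i in the lower one.
swap : Ser3 → Ser3
swap f i j l = f l j i

mirror : Var → Var
mirror X = Z
mirror Y = Y
mirror Z = X

swap-cong : ∀ {f g} → f ≈ g → swap f ≈ swap g
swap-cong p .at i j l = at p l j i

opaque
  unfolding _⊞_ ∂

  ∂-swap : ∀ v f → ∂ v (swap f) ≈ swap (∂ (mirror v) f)
  ∂-swap X f .at i j l = refl
  ∂-swap Y f .at i j l = refl
  ∂-swap Z f .at i j l = refl

  swap-⊞ : ∀ f g → swap (f ⊞ g) ≈ swap f ⊞ swap g
  swap-⊞ f g .at i j l = refl

  swap-⊟ : ∀ f → swap (⊟ f) ≈ ⊟ swap f
  swap-⊟ f .at i j l = refl

swap-⊠ : ∀ f g → swap (f ⊠ g) ≈ swap f ⊠ swap g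
swap-⊠ f g = taylor {Ser3 × Ser3} (λ (f , g) → swap (f ⊠ g)) (λ (f , g) → swap f ⊠ swap g)
  (λ v (f , g) → (∂ (mirror v) f , g) ∷ (f , ∂ (mirror v) g) ∷ [])
  (λ v (f , g) → ≈-trans (∂-swap v (f ⊠ g)) (≈-trans (swap-cong (∂-⊠ (mirror v) f g))
    (≈-trans (swap-⊞ (∂ (mirror v) f ⊠ g) (f ⊠ ∂ (mirror v) g)) (⊞-cong ≈-refl (≈-sym (⊞-identityʳ _))))))
  (λ v (f , g) → ≈-trans (∂-⊠ v (swap f) (swap g)) (⊞-cong
    (⊠-cong (∂-swap v f) ≈-refl)
    (≈-trans (⊠-cong ≈-refl (∂-swap v g)) (≈-sym (⊞-identityʳ _)))))
  (λ (f , g) → trans (⊠-at-0 f g) (sym (⊠-at-0 (swap f) (swap g))))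
  (f , g)

swap-⊠₃ : ∀ {f g h f′ g′ h′} R → swap f ≈[ R ] f′ → swap g ≈[ R ] g′ → swap h ≈[ R ] h′ →
  swap (f ⊠ g ⊠ h) ≈[ R ] f′ ⊠ g′ ⊠ h′
swap-⊠₃ {f} {g} {h} {f′} {g′} {h′} R p q r = begin
  swap (f ⊠ g ⊠ h)           ≈⟨ on (≈-trans (swap-⊠ (f ⊠ g) h) (⊠-cong (swap-⊠ f g) ≈-refl)) ⟩
  swap f ⊠ swap g ⊠ swap h   ≈⟨ ⊠-cong[] (⊠-cong[] p q) r ⟩
  f′ ⊠ g′ ⊠ h′               ∎
  where open Modulo R

swap-atX : ∀ f → swap (atX f) ≈ atZ f
swap-atX f .at zero    zero    l = refl
swap-atX f .at zero    (suc j) l = refl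
swap-atX f .at (suc i) zero    l = refl
swap-atX f .at (suc i) (suc j) l = refl

swap-atZ : ∀ f → swap (atZ f) ≈ atX f
swap-atZ f = swap-cong (≈-sym (swap-atX f))

swap-atXYZ : ∀ f → swap (atXYZ f) ≈ atXYZ f
swap-atXYZ f .at i j l
  rewrite trans (cong (ℕ._+ i) (ℕP.+-comm l j)) (trans (ℕP.+-comm (j ℕ.+ l) i) (sym (ℕP.+-assoc i j l))) =
  solve 5 (λ p g u v w → p :* g :* w :* v :* u := p :* g :* u :* v :* w) refl
    (f (i ℕ.+ j ℕ.+ l)) (ℕ→ℚ ((i ℕ.+ j ℕ.+ l) !)) (invFact i) (invFact j) (invFact l)
  where open +-*-Solver

swap-cosXY : swap cosXY ≈[ everywhere ∩ Y =0 ] cosZ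
swap-cosXY .at[] zero    zero l (_ , refl) = begin
  atXY cosS l 0 0   ≡⟨ atXY≡atXYZ cosS l 0 ⟩
  cosXYZ l 0 0      ≡⟨ at (swap-atXYZ cosS) 0 0 l ⟩
  cosXYZ 0 0 l      ≡⟨ at[] (atXYZ-edge cosS) 0 0 l ((tt , refl) , refl) ⟩
  cosZ 0 0 l        ∎
  where open ≡-Reasoning
swap-cosXY .at[] (suc i) zero l (_ , refl) = refl

-- A factor `h` annihilated by ∂u - ∂v behaves as a constant for this derivation.
∂-diff-⊠ : ∀ u v {f g h} → ∂ u f ≈ ∂ v f ⊞ g → ∂ u h ≈ ∂ v h → ∂ u (f ⊠ h) ≈ ∂ v (f ⊠ h) ⊞ g ⊠ h
∂-diff-⊠ u v {f} {g} {h} f′ h′ = begin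
  ∂ u (f ⊠ h)                              ≈⟨ ∂-⊠ u f h ⟩
  ∂ u f ⊠ h ⊞ f ⊠ ∂ u h                    ≈⟨ ⊞-cong (⊠-cong f′ ≈-refl) (⊠-cong ≈-refl h′) ⟩
  (∂ v f ⊞ g) ⊠ h ⊞ f ⊠ ∂ v h              ≈⟨ solve 5 (λ a g h f b → (a :+ g) :* h :+ f :* b := (a :* h :+ f :* b) :+ g :* h) ≈-refl (∂ v f) g h f (∂ v h) ⟩
  (∂ v f ⊠ h ⊞ f ⊠ ∂ v h) ⊞ g ⊠ h          ≈⟨ ⊞-cong (∂-⊠ v f h) ≈-refl ⟨
  ∂ v (f ⊠ h) ⊞ g ⊠ h                      ∎
  where
  open ≈-Reasoning
  open SemiringSolver Series.commutativeSemiring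

∂-diff-⊞ : ∀ u v {f g f₁ g₁} → ∂ u f ≈ ∂ v f ⊞ g → ∂ u f₁ ≈ ∂ v f₁ ⊞ g₁ →
  ∂ u (f ⊞ f₁) ≈ ∂ v (f ⊞ f₁) ⊞ (g ⊞ g₁)
∂-diff-⊞ u v {f} {g} {f₁} {g₁} p q = begin
  ∂ u (f ⊞ f₁)                        ≈⟨ ∂-⊞ u f f₁ ⟩
  ∂ u f ⊞ ∂ u f₁                      ≈⟨ ⊞-cong p q ⟩
  (∂ v f ⊞ g) ⊞ (∂ v f₁ ⊞ g₁)         ≈⟨ solve 4 (λ a g b h → (a :+ g) :+ (b :+ h) := (a :+ b) :+ (g :+ h)) ≈-refl (∂ v f) g (∂ v f₁) g₁ ⟩
  (∂ v f ⊞ ∂ v f₁) ⊞ (g ⊞ g₁)         ≈⟨ ⊞-cong (∂-⊞ v f f₁) ≈-refl ⟨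
  ∂ v (f ⊞ f₁) ⊞ (g ⊞ g₁)             ∎
  where
  open ≈-Reasoning
  open SemiringSolver Series.commutativeSemiring

∂-diff-flip : ∀ u v {f g} → ∂ u f ≈ ∂ v f ⊞ g → ∂ v f ≈ ∂ u f ⊞ ⊟ g
∂-diff-flip u v {f} {g} p = begin
  ∂ v f                   ≈⟨ ⊞-identityʳ (∂ v f) ⟨
  ∂ v f ⊞ 𝟘               ≈⟨ ⊞-cong ≈-refl (⊞-inverseʳ g) ⟨
  ∂ v f ⊞ (g ⊞ ⊟ g)       ≈⟨ ⊞-assoc (∂ v f) g (⊟ g) ⟨
  (∂ v f ⊞ g) ⊞ ⊟ g       ≈⟨ ⊞-cong p ≈-refl ⟨
  ∂ u f ⊞ ⊟ g             ∎
  where open ≈-Reasoning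

∂-diff-⊟ : ∀ u v {f g} → ∂ u f ≈ ∂ v f ⊞ g → ∂ v (⊟ f) ≈ ∂ u (⊟ f) ⊞ g
∂-diff-⊟ u v {f} {g} p = begin
  ∂ v (⊟ f)                    ≈⟨ ∂-⊟ v f ⟩
  ⊟ ∂ v f                      ≈⟨ ⊟-cong (∂-diff-flip u v p) ⟩
  ⊟ (∂ u f ⊞ ⊟ g)              ≈⟨ -‿+-comm (∂ u f) (⊟ g) ⟨
  ⊟ ∂ u f ⊞ ⊟ ⊟ g              ≈⟨ ⊞-cong (≈-sym (∂-⊟ u f)) (-‿involutive g) ⟩
  ∂ u (⊟ f) ⊞ g                ∎
  where
  open ≈-Reasoning
  open RingProperties Series.ring using (-‿+-comm; -‿involutive)

∂Y-cosX : ∂ Y cosX ≈ ∂ X cosX ⊞ sinX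
∂Y-cosX = ≈-trans (∂Y-atX cosS) (≈-sym (⊞-⊟-vanish ∂X-cosX))

∂X-sinX-diff : ∂ X sinX ≈ ∂ Y sinX ⊞ cosX
∂X-sinX-diff = ≈-trans ∂X-sinX (≈-trans (≈-sym (⊞-identityˡ cosX)) (⊞-cong (≈-sym (∂Y-atX sinS)) ≈-refl))

∂X-atZ≈∂Y-atZ : ∀ f → ∂ X (atZ f) ≈ ∂ Y (atZ f)
∂X-atZ≈∂Y-atZ f = ≈-trans (∂X-atZ f) (≈-sym (∂Y-atZ f))

∂X-atXYZ≈∂Y-atXYZ : ∀ f → ∂ X (atXYZ f) ≈ ∂ Y (atXYZ f)
∂X-atXYZ≈∂Y-atXYZ f = ≈-trans (∂-atXYZ X f) (≈-sym (∂-atXYZ Y f))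

-- The exponential generating functions of the entries above (U) and below (L)
-- the diagonal of the matrices A and B satisfy this system.
record Solution (AU AL BU BL : Ser3) : Set where
  field
    AU-diff : ∂ Y AU ≈ ∂ X AU ⊞ BU
    AL-diff : ∂ X AL ≈ ∂ Y AL ⊞ BL
    BU-diff : ∂ X BU ≈ ∂ Y BU ⊞ AU
    BL-diff : ∂ Y BL ≈ ∂ X BL ⊞ AL
    BU-face : BU ≈[ everywhere ∩ X =0 ] 𝟘
    AL-face : ∂ Z AL ≈[ everywhere ∩ X =0 ] BL
    AL-edge : AL ≈[ everywhere ∩ X =0 ∩ Z =0 ] 𝟘
    AU-diag : AU ≈[ everywhere ∩ Y =0 ] swap AL
    BL-diag : swap BL ≈[ everywhere ∩ Y =0 ] BU ⊞ 𝟙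

closedAU closedAL closedBU closedBL : Ser3
closedAU = cosX ⊠ cosZ ⊠ sinXYZ ⊠ sec²XYZ
closedAL = cosX ⊠ sinZ ⊠ secXYZ ⊞ sinX ⊠ cosXY ⊠ sec²XYZ
closedBU = sinX ⊠ cosZ ⊠ sinXYZ ⊠ sec²XYZ
closedBL = ⊟ (sinX ⊠ sinZ ⊠ secXYZ) ⊞ cosX ⊠ cosXY ⊠ sec²XYZ

closed-solution : Solution closedAU closedAL closedBU closedBL
closed-solution = record
  { AU-diff = ∂-diff-⊠ Y X (∂-diff-⊠ Y X (∂-diff-⊠ Y X ∂Y-cosX (≈-sym cosZ′)) (≈-sym sinXYZ′)) (≈-sym sec²XYZ′)
  ; AL-diff = ∂-diff-⊞ X Y
      (∂-diff-flip Y X (∂-diff-⊠ Y X (∂-diff-⊠ Y X ∂Y-cosX (≈-sym sinZ′)) (≈-sym secXYZ′)))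
      (∂-diff-⊠ X Y (∂-diff-⊠ X Y ∂X-sinX-diff cosXY′) sec²XYZ′)
  ; BU-diff = ∂-diff-⊠ X Y (∂-diff-⊠ X Y (∂-diff-⊠ X Y ∂X-sinX-diff cosZ′) sinXYZ′) sec²XYZ′
  ; BL-diff = ∂-diff-⊞ Y X
      -- sin x obeys the rule with X and Y exchanged; the minus sign in front of this term exchanges
      -- them back.
      (∂-diff-⊟ X Y (∂-diff-⊠ X Y (∂-diff-⊠ X Y ∂X-sinX-diff sinZ′) secXYZ′))
      (∂-diff-⊠ Y X (∂-diff-⊠ Y X ∂Y-cosX (≈-sym cosXY′)) (≈-sym sec²XYZ′))
  ; BU-face = BU-face
  ; AL-face = AL-face
  ; AL-edge = AL-edge
  ; AU-diag = AU-diag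
  ; BL-diag = BL-diag
  }
  where
  cosZ′    = ∂X-atZ≈∂Y-atZ cosS
  sinZ′    = ∂X-atZ≈∂Y-atZ sinS
  cosXY′   = ∂X-atXY cosS
  sinXYZ′  = ∂X-atXYZ≈∂Y-atXYZ sinS
  secXYZ′  = ∂X-atXYZ≈∂Y-atXYZ (recip₁ cosS)
  sec²XYZ′ = ∂X-atXYZ≈∂Y-atXYZ (recip₁ (cosS *₁ cosS))

  BU-face : closedBU ≈[ everywhere ∩ X =0 ] 𝟘
  BU-face = begin
    sinX ⊠ cosZ ⊠ sinXYZ ⊠ sec²XYZ  ≈⟨ ⊠-cong[] (⊠-cong[] (⊠-cong[] sinX-face ≋-refl) ≋-refl) ≋-refl ⟩
    𝟘 ⊠ cosZ ⊠ sinXYZ ⊠ sec²XYZ     ≈⟨ solve 3 (λ a b c → con 0 :* a :* b :* c := con 0) ≋-refl cosZ sinXYZ sec²XYZ ⟩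
    𝟘                               ∎
    where open Modulo (everywhere ∩ X =0)

  AL-on-face : closedAL ≈[ everywhere ∩ X =0 ] sinZ ⊠ secXYZ
  AL-on-face = begin
    cosX ⊠ sinZ ⊠ secXYZ ⊞ sinX ⊠ cosXY ⊠ sec²XYZ
      ≈⟨ ⊞-cong[] (⊠-cong[] (⊠-cong[] cosX-face ≋-refl) ≋-refl) (⊠-cong[] (⊠-cong[] sinX-face ≋-refl) ≋-refl) ⟩
    𝟙 ⊠ sinZ ⊠ secXYZ ⊞ 𝟘 ⊠ cosXY ⊠ sec²XYZ
      ≈⟨ solve 4 (λ a b c d → con 1 :* a :* b :+ con 0 :* c :* d := a :* b) ≋-refl sinZ secXYZ cosXY sec²XYZ ⟩
    sinZ ⊠ secXYZ ∎
    where open Modulo (everywhere ∩ X =0)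

  BL-on-face : closedBL ≈[ everywhere ∩ X =0 ] cosXY ⊠ sec²XYZ
  BL-on-face = Algebraic.subtract (Ser3/ (everywhere ∩ X =0)) (begin
    cosX ⊠ cosXY ⊠ sec²XYZ  ≈⟨ ⊠-cong[] (⊠-cong[] cosX-face ≋-refl) ≋-refl ⟩
    𝟙 ⊠ cosXY ⊠ sec²XYZ     ≈⟨ solve 4 (λ a b c d → con 1 :* a :* b := a :* b :+ con 0 :* c :* d) ≋-refl cosXY sec²XYZ sinZ secXYZ ⟩
    cosXY ⊠ sec²XYZ ⊞ 𝟘 ⊠ sinZ ⊠ secXYZ     ≈⟨ ⊞-cong[] ≋-refl (⊠-cong[] (⊠-cong[] sinX-face ≋-refl) ≋-refl) ⟨
    cosXY ⊠ sec²XYZ ⊞ sinX ⊠ sinZ ⊠ secXYZ  ∎)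
    where open Modulo (everywhere ∩ X =0)

  AL-face : ∂ Z closedAL ≈[ everywhere ∩ X =0 ] closedBL
  AL-face = begin
    ∂ Z closedAL                                    ≈⟨ ∂Z-cong[X=0] AL-on-face ⟩
    ∂ Z (sinZ ⊠ secXYZ)                             ≈⟨ on (∂-⊠ Z sinZ secXYZ) ⟩
    ∂ Z sinZ ⊠ secXYZ ⊞ sinZ ⊠ ∂ Z secXYZ           ≈⟨ on (⊞-cong (⊠-cong ∂Z-sinZ ≈-refl) (⊠-cong ≈-refl ∂Z-secXYZ)) ⟩
    cosZ ⊠ secXYZ ⊞ sinZ ⊠ (secXYZ ⊠ secXYZ ⊠ sinXYZ)  ≈⟨ Algebraic.edge (Ser3/ (everywhere ∩ X =0)) (on secant) (on secant²) (restrict cosXY-expand) ⟩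
    cosXY ⊠ sec²XYZ                                 ≈⟨ BL-on-face ⟨
    closedBL                                        ∎
    where open Modulo (everywhere ∩ X =0)

  AL-edge : closedAL ≈[ everywhere ∩ X =0 ∩ Z =0 ] 𝟘
  AL-edge = begin
    closedAL       ≈⟨ restrict AL-on-face ⟩
    sinZ ⊠ secXYZ  ≈⟨ ⊠-cong[] sinZ-face ≋-refl ⟩
    𝟘 ⊠ secXYZ     ≈⟨ on (⊠-zeroˡ secXYZ) ⟩
    𝟘              ∎
    where open Modulo (everywhere ∩ X =0 ∩ Z =0)

  open Modulo (everywhere ∩ Y =0)
  open Algebraic (Ser3/ (everywhere ∩ Y =0))

  swap-sec : swap secXYZ ≈[ everywhere ∩ Y =0 ] secXYZ
  swap-sec = on (swap-atXYZ (recip₁ cosS))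

  swap-sec² : swap sec²XYZ ≈[ everywhere ∩ Y =0 ] sec²XYZ
  swap-sec² = on (swap-atXYZ (recip₁ (cosS *₁ cosS)))

  AU-diag : closedAU ≈[ everywhere ∩ Y =0 ] swap closedAL
  AU-diag = begin
    cosX ⊠ cosZ ⊠ sinXYZ ⊠ sec²XYZ
      ≈⟨ upper-diagonal (restrict pythagoras) cos-sub sin-sub (on secant) (on secant²) ⟩
    cosZ ⊠ sinX ⊠ secXYZ ⊞ sinZ ⊠ cosZ ⊠ sec²XYZ
      ≈⟨ ⊞-cong[]
           (swap-⊠₃ (everywhere ∩ Y =0) (on (swap-atX cosS)) (on (swap-atZ sinS)) swap-sec)
           (swap-⊠₃ (everywhere ∩ Y =0) (on (swap-atX sinS)) swap-cosXY swap-sec²) ⟨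
    swap (cosX ⊠ sinZ ⊠ secXYZ) ⊞ swap (sinX ⊠ cosXY ⊠ sec²XYZ)
      ≈⟨ on (swap-⊞ (cosX ⊠ sinZ ⊠ secXYZ) (sinX ⊠ cosXY ⊠ sec²XYZ)) ⟨
    swap closedAL ∎

  BL-diag : swap closedBL ≈[ everywhere ∩ Y =0 ] closedBU ⊞ 𝟙
  BL-diag = begin
    swap closedBL
      ≈⟨ on (≈-trans (swap-⊞ (⊟ (sinX ⊠ sinZ ⊠ secXYZ)) (cosX ⊠ cosXY ⊠ sec²XYZ))
           (⊞-cong (swap-⊟ (sinX ⊠ sinZ ⊠ secXYZ)) ≈-refl)) ⟩
    ⊟ swap (sinX ⊠ sinZ ⊠ secXYZ) ⊞ swap (cosX ⊠ cosXY ⊠ sec²XYZ)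
      ≈⟨ ⊞-cong[]
           (⊟-cong[] (swap-⊠₃ (everywhere ∩ Y =0) (on (swap-atX sinS)) (on (swap-atZ sinS)) swap-sec))
           (swap-⊠₃ (everywhere ∩ Y =0) (on (swap-atX cosS)) swap-cosXY swap-sec²) ⟩
    ⊟ (sinZ ⊠ sinX ⊠ secXYZ) ⊞ cosZ ⊠ cosZ ⊠ sec²XYZ
      ≈⟨ subtract (lower-diagonal (restrict pythagoras) cos-sub sin-sub (on secant) (on secant²)) ⟩
    closedBU ⊞ 𝟙 ∎

-- The entries of the twin Seidel matrices

-- The exponents of (m,k) in order n are m-1, k-m-1, n-1-k above the diagonal and n-1-m, m-k-1, k-1
-- below it; they add up to n-3, so raising one of them raises the order. The constants stand in
-- front so that the indices reduce by computation. All orders are covered; parity enters with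
-- `egf`.
upper lower : Mat → ℕ → ℕ → ℕ → ℕ
upper c i j l = c (3 ℕ.+ (i ℕ.+ j ℕ.+ l)) (suc i) (2 ℕ.+ (i ℕ.+ j))
lower c i j l = c (3 ℕ.+ (i ℕ.+ j ℕ.+ l)) (2 ℕ.+ (j ℕ.+ l)) (suc l)

module Entries {a b : Mat} (T : TwinSeidel a b) where
  open TwinSeidel T

  private
    3≤3+ : ∀ {n} → 3 ≤ 3 ℕ.+ n
    3≤3+ = s≤s (s≤s (s≤s z≤n))

    m+2≤2+i : ∀ {m i} → m ≤ i → m ℕ.+ 2 ≤ 2 ℕ.+ i
    m+2≤2+i {m} {i} m≤i = subst (_≤ 2 ℕ.+ i) (ℕP.+-comm 2 m) (s≤s (s≤s m≤i))

    3≤1+m+2 : ∀ {m} → 3 ≤ suc m ℕ.+ 2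
    3≤1+m+2 {m} = s≤s (ℕP.m≤n+m 2 m)

    j+l≤i+j+l : ∀ i j l → j ℕ.+ l ≤ i ℕ.+ j ℕ.+ l
    j+l≤i+j+l i j l = ℕP.+-monoˡ-≤ l (ℕP.m≤n+m j i)

  bu-face : ∀ j l → upper b 0 j l ≡ 0
  bu-face j l = ts2-bRow _ _ 3≤3+ (s≤s z≤n) (s≤s (s≤s (ℕP.m≤n⇒m≤1+n (ℕP.m≤m+n j l))))

  bu-step : ∀ i j l → upper b (suc i) j l ≡ upper b i (suc j) l ℕ.+ upper a i j l
  bu-step i j l rewrite ℕP.+-suc i j =
    ts4-above _ (suc i) _ 3≤3+ 3≤1+m+2 (m+2≤2+i (s≤s (ℕP.m≤m+n i j))) (s≤s (s≤s (s≤s (ℕP.m≤m+n (i ℕ.+ j) l))))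

  au-step : ∀ i j l → upper a i (suc j) l ≡ upper a (suc i) j l ℕ.+ upper b i j l
  au-step i j l rewrite ℕP.+-suc i j =
    ts5-above _ (suc i) _ 3≤3+ 3≤1+m+2 (m+2≤2+i (s≤s (ℕP.m≤m+n i j))) (s≤s (s≤s (s≤s (ℕP.m≤m+n (i ℕ.+ j) l))))

  bl-step : ∀ i j l → lower b i (suc j) l ≡ lower b (suc i) j l ℕ.+ lower a i j l
  bl-step i j l rewrite ℕP.+-suc i j =
    ts4-below _ (2 ℕ.+ (j ℕ.+ l)) (suc l) 3≤3+ (s≤s (s≤s z≤n)) (s≤s (s≤s (ℕP.m≤n+m l j))) (s≤s (s≤s (j+l≤i+j+l i j l)))

  al-step : ∀ i j l → lower a (suc i) j l ≡ lower a i (suc j) l ℕ.+ lower b i j l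
  al-step i j l rewrite ℕP.+-suc i j =
    ts5-below _ (2 ℕ.+ (j ℕ.+ l)) (suc l) 3≤3+ (s≤s (s≤s z≤n)) (s≤s (s≤s (ℕP.m≤n+m l j)))
      (ℕP.m≤n⇒m≤1+n (s≤s (s≤s (j+l≤i+j+l i j l))))

  -- Both b(n,k+1) and b(n-1,k) are the k-th column sum of the preceding A.
  al-face : ∀ j l → lower a 0 j (suc l) ≡ lower b 0 j l
  al-face j l rewrite ℕP.+-suc j l = begin
    a (4 ℕ.+ t) (3 ℕ.+ t) (2 ℕ.+ l)
      ≡⟨ ts5-below _ _ _ 3≤3+ (s≤s (s≤s z≤n)) 3+l≤3+t ℕP.≤-refl ⟩
    a (4 ℕ.+ t) (4 ℕ.+ t) (2 ℕ.+ l) ℕ.+ b (3 ℕ.+ t) (3 ℕ.+ t) (2 ℕ.+ l)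
      ≡⟨ cong (ℕ._+ b (3 ℕ.+ t) (3 ℕ.+ t) (2 ℕ.+ l)) (ts2-aRow _ _ 3≤3+ (s≤s z≤n) (ℕP.≤-trans (ℕP.n≤1+n _) (ℕP.m≤n⇒m≤1+n 3+l≤3+t))) ⟩
    b (3 ℕ.+ t) (3 ℕ.+ t) (2 ℕ.+ l)
      ≡⟨ ts4-last _ _ 3≤3+ (s≤s (s≤s z≤n)) (s≤s (s≤s l≤t)) ⟩
    colSum a (2 ℕ.+ t) (suc l)
      ≡⟨ ts4-penult _ _ 3≤3+ (s≤s z≤n) (s≤s l≤t) ⟨
    b (3 ℕ.+ t) (2 ℕ.+ t) (suc l) ∎
    where
    open ≡-Reasoning
    t = j ℕ.+ l
    l≤t : l ≤ t
    l≤t = ℕP.m≤n+m l j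
    3+l≤3+t : 3 ℕ.+ l ≤ 3 ℕ.+ t
    3+l≤3+t = s≤s (s≤s (s≤s l≤t))

  -- In the first column, (TS5) leaves a last-row entry of A and the bottom left corner of the
  -- preceding B. Order 3 is left out because that corner is b_2(2,1) = 1; its term has degree 0,
  -- which is even and so does not occur for A.
  al-edge : ∀ j → lower a 0 (suc j) 0 ≡ 0
  al-edge j rewrite ℕP.+-identityʳ j = trans
    (ts5-below (4 ℕ.+ j) (3 ℕ.+ j) 1 3≤3+ (s≤s (s≤s z≤n)) (s≤s (s≤s z≤n)) ℕP.≤-refl)
    (cong₂ ℕ._+_ (ts2-aRow _ 1 3≤3+ ℕP.≤-refl (s≤s z≤n)) (ts2-bCorner _ 3≤3+))

  -- The (TS5) recurrences telescope the column sum that is the top entry of column i+2 of A.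
  a-diag : ∀ i l → a (3 ℕ.+ (i ℕ.+ l)) (suc i) (2 ℕ.+ i) ≡ a (3 ℕ.+ (i ℕ.+ l)) (2 ℕ.+ i) (suc i)
  a-diag i l = ℕP.+-cancelˡ-≡ (Σ i) _ _ (begin
    Σ i ℕ.+ a n (suc i) (2 ℕ.+ i)                        ≡⟨ above i ℕP.≤-refl ⟩
    a n 1 (2 ℕ.+ i)                                      ≡⟨ ts5-first n (2 ℕ.+ i) 3≤3+ (s≤s (s≤s z≤n)) (s≤s (s≤s (ℕP.m≤m+n i l))) ⟩
    Σ (2 ℕ.+ (i ℕ.+ l))                                  ≡⟨ cong Σ l+i ⟨
    Σ (suc l ℕ.+ suc i)                                  ≡⟨ cong (ℕ._+ Σ (suc l ℕ.+ suc i)) last-row ⟨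
    a n (suc (suc l ℕ.+ suc i)) (suc i) ℕ.+ Σ (suc l ℕ.+ suc i)  ≡⟨ below (suc l) ℕP.≤-refl ⟩
    a n (2 ℕ.+ i) (suc i) ℕ.+ Σ (suc i)                  ≡⟨ ℕP.+-comm (a n (2 ℕ.+ i) (suc i)) (Σ (suc i)) ⟩
    Σ (suc i) ℕ.+ a n (2 ℕ.+ i) (suc i)                  ≡⟨ cong (ℕ._+ a n (2 ℕ.+ i) (suc i)) diagonal ⟩
    Σ i ℕ.+ a n (2 ℕ.+ i) (suc i)                        ∎)
    where
    open ≡-Reasoning
    n = 3 ℕ.+ (i ℕ.+ l)
    Σ : ℕ → ℕ
    Σ m = Σ₁ m (λ m → b (2 ℕ.+ (i ℕ.+ l)) m (suc i))

    l+i : suc l ℕ.+ suc i ≡ 2 ℕ.+ (i ℕ.+ l)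
    l+i = cong suc (trans (ℕP.+-suc l i) (cong suc (ℕP.+-comm l i)))

    -- The recurrences skip the diagonal; since the entry of B there is zero, the telescoped sums
    -- from above and below meet.
    diagonal : Σ (suc i) ≡ Σ i
    diagonal = trans (cong (Σ i ℕ.+_) (ts1b _ _ (s≤s (s≤s z≤n)) (s≤s z≤n) (s≤s (ℕP.m≤n⇒m≤1+n (ℕP.m≤m+n i l)))))
      (ℕP.+-identityʳ (Σ i))

    last-row : a n (suc (suc l ℕ.+ suc i)) (suc i) ≡ 0
    last-row = trans (cong (λ m → a n (suc m) (suc i)) l+i)
      (ts2-aRow n (suc i) 3≤3+ (s≤s z≤n) (s≤s (ℕP.m≤n⇒m≤1+n (ℕP.m≤n⇒m≤1+n (ℕP.m≤m+n i l)))))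

    above : ∀ m → m ≤ i → Σ m ℕ.+ a n (suc m) (2 ℕ.+ i) ≡ a n 1 (2 ℕ.+ i)
    above zero    _   = refl
    above (suc m) m<i = begin
      Σ m ℕ.+ b (2 ℕ.+ (i ℕ.+ l)) (suc m) (suc i) ℕ.+ a n (2 ℕ.+ m) (2 ℕ.+ i)
        ≡⟨ ℕP.+-assoc (Σ m) _ _ ⟩
      Σ m ℕ.+ (b (2 ℕ.+ (i ℕ.+ l)) (suc m) (suc i) ℕ.+ a n (2 ℕ.+ m) (2 ℕ.+ i))
        ≡⟨ cong (Σ m ℕ.+_) (ℕP.+-comm (b (2 ℕ.+ (i ℕ.+ l)) (suc m) (suc i)) _) ⟩
      Σ m ℕ.+ (a n (2 ℕ.+ m) (2 ℕ.+ i) ℕ.+ b (2 ℕ.+ (i ℕ.+ l)) (suc m) (suc i))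
        ≡⟨ cong (Σ m ℕ.+_) (ts5-above n (suc m) (2 ℕ.+ i) 3≤3+ 3≤1+m+2 (m+2≤2+i m<i) (s≤s (s≤s (ℕP.m≤m+n i l)))) ⟨
      Σ m ℕ.+ a n (suc m) (2 ℕ.+ i)
        ≡⟨ above m (ℕP.<⇒≤ m<i) ⟩
      a n 1 (2 ℕ.+ i) ∎

    below : ∀ t → t ≤ suc l →
      a n (suc (t ℕ.+ suc i)) (suc i) ℕ.+ Σ (t ℕ.+ suc i) ≡ a n (2 ℕ.+ i) (suc i) ℕ.+ Σ (suc i)
    below zero    _   = refl
    below (suc t) (s≤s t≤l) = begin
      a n (suc m) (suc i) ℕ.+ (Σ (t ℕ.+ suc i) ℕ.+ b (2 ℕ.+ (i ℕ.+ l)) m (suc i))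
        ≡⟨ cong (a n (suc m) (suc i) ℕ.+_) (ℕP.+-comm (Σ (t ℕ.+ suc i)) _) ⟩
      a n (suc m) (suc i) ℕ.+ (b (2 ℕ.+ (i ℕ.+ l)) m (suc i) ℕ.+ Σ (t ℕ.+ suc i))
        ≡⟨ ℕP.+-assoc (a n (suc m) (suc i)) _ _ ⟨
      a n (suc m) (suc i) ℕ.+ b (2 ℕ.+ (i ℕ.+ l)) m (suc i) ℕ.+ Σ (t ℕ.+ suc i)
        ≡⟨ cong (ℕ._+ Σ (t ℕ.+ suc i)) (ts5-below n m (suc i) 3≤3+ (s≤s (s≤s z≤n)) (s≤s (ℕP.m≤n+m (suc i) t)) m≤) ⟨
      a n m (suc i) ℕ.+ Σ (t ℕ.+ suc i)
        ≡⟨ below t (ℕP.m≤n⇒m≤1+n t≤l) ⟩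
      a n (2 ℕ.+ i) (suc i) ℕ.+ Σ (suc i) ∎
      where
      m = suc (t ℕ.+ suc i)
      m≤ : m ≤ 2 ℕ.+ (i ℕ.+ l)
      m≤ = subst (m ≤_) l+i (s≤s (ℕP.+-monoˡ-≤ (suc i) t≤l))

  -- Above the diagonal the differences start at the zero first row and add up the top of a column
  -- of A. Below, they add up the rest of it, ending in row n-1, which holds the whole column sum.
  -- The two agree because the diagonal entry of A vanishes; `1 ≤ i ℕ.+ l` excludes order 3, whose
  -- predecessor A_2 has the diagonal entry 1.
  b-diag : ∀ i l → 1 ≤ i ℕ.+ l → b (3 ℕ.+ (i ℕ.+ l)) (2 ℕ.+ i) (suc i) ≡ b (3 ℕ.+ (i ℕ.+ l)) (suc i) (2 ℕ.+ i)
  b-diag i l 1≤i+l = ℕP.+-cancelʳ-≡ (Σ (l ℕ.+ suc i)) _ _ (begin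
    b n (2 ℕ.+ i) (suc i) ℕ.+ Σ (l ℕ.+ suc i)                ≡⟨ below l ℕP.≤-refl ⟩
    b n (suc (l ℕ.+ suc i)) (suc i) ℕ.+ Σ (suc i)            ≡⟨ cong₂ ℕ._+_ penultimate diagonal ⟩
    Σ (l ℕ.+ suc i) ℕ.+ Σ i                                  ≡⟨ ℕP.+-comm (Σ (l ℕ.+ suc i)) (Σ i) ⟩
    Σ i ℕ.+ Σ (l ℕ.+ suc i)                                  ≡⟨ cong (ℕ._+ Σ (l ℕ.+ suc i)) (above i ℕP.≤-refl) ⟨
    b n (suc i) (2 ℕ.+ i) ℕ.+ Σ (l ℕ.+ suc i)                ∎)
    where
    open ≡-Reasoning
    n = 3 ℕ.+ (i ℕ.+ l)
    Σ : ℕ → ℕ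
    Σ m = Σ₁ m (λ m → a (2 ℕ.+ (i ℕ.+ l)) m (suc i))

    l+i : suc (l ℕ.+ suc i) ≡ 2 ℕ.+ (i ℕ.+ l)
    l+i = cong suc (trans (ℕP.+-suc l i) (cong suc (ℕP.+-comm l i)))

    diagonal : Σ (suc i) ≡ Σ i
    diagonal = trans
      (cong (Σ i ℕ.+_) (ts1a _ _ (s≤s (s≤s z≤n)) (s≤s z≤n) (s≤s (ℕP.m≤n⇒m≤1+n (ℕP.m≤m+n i l)))
        (λ (n≡2 , _) → ℕP.<⇒≢ (s≤s (s≤s 1≤i+l)) (sym n≡2))))
      (ℕP.+-identityʳ (Σ i))

    penultimate : b n (suc (l ℕ.+ suc i)) (suc i) ≡ Σ (l ℕ.+ suc i)
    penultimate = begin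
      b n (suc (l ℕ.+ suc i)) (suc i)    ≡⟨ cong (λ m → b n m (suc i)) l+i ⟩
      b n (2 ℕ.+ (i ℕ.+ l)) (suc i)      ≡⟨ ts4-penult n (suc i) 3≤3+ (s≤s z≤n) (s≤s (ℕP.m≤m+n i l)) ⟩
      Σ (2 ℕ.+ (i ℕ.+ l))                ≡⟨ cong (Σ (suc (i ℕ.+ l)) ℕ.+_) (ts2-aRow _ _ (s≤s (s≤s 1≤i+l)) (s≤s z≤n) (s≤s (ℕP.m≤n⇒m≤1+n (ℕP.m≤m+n i l)))) ⟩
      Σ (suc (i ℕ.+ l)) ℕ.+ 0            ≡⟨ ℕP.+-identityʳ _ ⟩
      Σ (suc (i ℕ.+ l))                  ≡⟨ cong Σ (ℕP.suc-injective l+i) ⟨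
      Σ (l ℕ.+ suc i)                    ∎

    above : ∀ m → m ≤ i → b n (suc m) (2 ℕ.+ i) ≡ Σ m
    above zero    _   = ts2-bRow n (2 ℕ.+ i) 3≤3+ (s≤s z≤n) (s≤s (s≤s (ℕP.m≤n⇒m≤1+n (ℕP.m≤m+n i l))))
    above (suc m) m<i = trans
      (ts4-above n (suc m) (2 ℕ.+ i) 3≤3+ 3≤1+m+2 (m+2≤2+i m<i) (s≤s (s≤s (ℕP.m≤m+n i l))))
      (cong (ℕ._+ a (2 ℕ.+ (i ℕ.+ l)) (suc m) (suc i)) (above m (ℕP.<⇒≤ m<i)))

    below : ∀ t → t ≤ l →
      b n (2 ℕ.+ i) (suc i) ℕ.+ Σ (t ℕ.+ suc i) ≡ b n (suc (t ℕ.+ suc i)) (suc i) ℕ.+ Σ (suc i)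
    below zero    _   = refl
    below (suc t) t<l = begin
      b n (2 ℕ.+ i) (suc i) ℕ.+ (Σ (t ℕ.+ suc i) ℕ.+ a (2 ℕ.+ (i ℕ.+ l)) m (suc i))
        ≡⟨ ℕP.+-assoc (b n (2 ℕ.+ i) (suc i)) _ _ ⟨
      b n (2 ℕ.+ i) (suc i) ℕ.+ Σ (t ℕ.+ suc i) ℕ.+ a (2 ℕ.+ (i ℕ.+ l)) m (suc i)
        ≡⟨ cong (ℕ._+ a (2 ℕ.+ (i ℕ.+ l)) m (suc i)) (below t (ℕP.<⇒≤ t<l)) ⟩
      b n m (suc i) ℕ.+ Σ (suc i) ℕ.+ a (2 ℕ.+ (i ℕ.+ l)) m (suc i)
        ≡⟨ ℕP.+-assoc (b n m (suc i)) _ _ ⟩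
      b n m (suc i) ℕ.+ (Σ (suc i) ℕ.+ a (2 ℕ.+ (i ℕ.+ l)) m (suc i))
        ≡⟨ cong (b n m (suc i) ℕ.+_) (ℕP.+-comm (Σ (suc i)) _) ⟩
      b n m (suc i) ℕ.+ (a (2 ℕ.+ (i ℕ.+ l)) m (suc i) ℕ.+ Σ (suc i))
        ≡⟨ ℕP.+-assoc (b n m (suc i)) _ _ ⟨
      b n m (suc i) ℕ.+ a (2 ℕ.+ (i ℕ.+ l)) m (suc i) ℕ.+ Σ (suc i)
        ≡⟨ cong (ℕ._+ Σ (suc i)) (ts4-below n m (suc i) 3≤3+ (s≤s (s≤s z≤n)) (s≤s (ℕP.m≤n+m (suc i) t)) m≤) ⟨
      b n (suc m) (suc i) ℕ.+ Σ (suc i) ∎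
      where
      m = suc (t ℕ.+ suc i)
      m≤ : m ≤ suc (i ℕ.+ l)
      m≤ = subst (m ≤_) (ℕP.suc-injective l+i) (ℕP.+-monoˡ-≤ (suc i) t<l)

  au-diag : ∀ i l → upper a i 0 l ≡ lower a l 0 i
  au-diag i l rewrite ℕP.+-identityʳ i | ℕP.+-identityʳ l | ℕP.+-comm l i = a-diag i l

  bl-diag : ∀ i l → 1 ≤ i ℕ.+ l → lower b l 0 i ≡ upper b i 0 l
  bl-diag i l rewrite ℕP.+-identityʳ i | ℕP.+-identityʳ l | ℕP.+-comm l i = b-diag i l

  -- The first column sum of A_2, and the source of the `𝟙` in `BL-diag`.
  bl-origin : lower b 0 0 0 ≡ 1
  bl-origin = trans (ts4-penult 3 1 3≤3+ ℕP.≤-refl ℕP.≤-refl) (cong₂ ℕ._+_ ts3-a11 ts3-a21)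

-- Only B of odd and A of even order enter, so that the degree i+j+l of the
-- term for b(n) is even and that for a(n) is odd.
isOdd : ℕ → Bool
isOdd n = not (isEven n)

isEven-suc : ∀ n → isEven (suc n) ≡ isOdd n
isEven-suc zero          = refl
isEven-suc (suc zero)    = refl
isEven-suc (suc (suc n)) = isEven-suc n

isOdd-suc : ∀ n → isOdd (suc n) ≡ isEven n
isOdd-suc n = trans (cong not (isEven-suc n)) (not-involutive (isEven n))

-- Exponential generating functions of the entries

weighted : Bool → ℕ → Ser3
weighted p c i j l = if p then ℕ→ℚ c * invFact i * invFact j * invFact l else 0ℚ

egf : (ℕ → Bool) → (ℕ → ℕ → ℕ → ℕ) → Ser3
egf p e i j l = weighted (p (i ℕ.+ j ℕ.+ l)) (e i j l) i j l

weighted-0 : ∀ p i j l → weighted p 0 i j l ≡ 0ℚ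
weighted-0 false i j l = refl
weighted-0 true  i j l = solve 3 (λ u v w → con 0ℚ :* u :* v :* w := con 0ℚ) refl (invFact i) (invFact j) (invFact l)
  where open +-*-Solver

weighted-+ : ∀ p c d i j l → weighted p (c ℕ.+ d) i j l ≡ weighted p c i j l + weighted p d i j l
weighted-+ false c d i j l = refl
weighted-+ true  c d i j l = trans
  (cong (λ q → q * invFact i * invFact j * invFact l) (ℕ→ℚ-+ c d))
  (solve 5 (λ c d u v w → (c :+ d) :* u :* v :* w := c :* u :* v :* w :+ d :* u :* v :* w) refl
    (ℕ→ℚ c) (ℕ→ℚ d) (invFact i) (invFact j) (invFact l))
  where open +-*-Solver

weighted-swap : ∀ p c i j l → weighted p c l j i ≡ weighted p c i j l
weighted-swap false c i j l = refl
weighted-swap true  c i j l =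
  solve 4 (λ c u v w → c :* w :* v :* u := c :* u :* v :* w) refl (ℕ→ℚ c) (invFact i) (invFact j) (invFact l)
  where open +-*-Solver

weighted-∂X : ∀ p c i j l → ℕ→ℚ (suc i) * weighted p c (suc i) j l ≡ weighted p c i j l
weighted-∂X false c i j l = ℚP.*-zeroʳ (ℕ→ℚ (suc i))
weighted-∂X true  c i j l = trans
  (solve 5 (λ s c u v w → s :* (c :* u :* v :* w) := c :* (s :* u) :* v :* w) refl
    (ℕ→ℚ (suc i)) (ℕ→ℚ c) (invFact (suc i)) (invFact j) (invFact l))
  (cong (λ q → ℕ→ℚ c * q * invFact j * invFact l) (suc-invFact i))
  where open +-*-Solver

weighted-∂Y : ∀ p c i j l → ℕ→ℚ (suc j) * weighted p c i (suc j) l ≡ weighted p c i j l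
weighted-∂Y false c i j l = ℚP.*-zeroʳ (ℕ→ℚ (suc j))
weighted-∂Y true  c i j l = trans
  (solve 5 (λ s c u v w → s :* (c :* u :* v :* w) := c :* u :* (s :* v) :* w) refl
    (ℕ→ℚ (suc j)) (ℕ→ℚ c) (invFact i) (invFact (suc j)) (invFact l))
  (cong (λ q → ℕ→ℚ c * invFact i * q * invFact l) (suc-invFact j))
  where open +-*-Solver

weighted-∂Z : ∀ p c i j l → ℕ→ℚ (suc l) * weighted p c i j (suc l) ≡ weighted p c i j l
weighted-∂Z p c i j l = trans (cong (ℕ→ℚ (suc l) *_) (weighted-swap p c (suc l) j i))
  (trans (weighted-∂X p c l j i) (weighted-swap p c i j l))

opaque
  unfolding _⊞_ ∂

  -- The factorials turn differentiation into an index shift. The degree drops by one, so the parity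
  -- test `p` becomes `q`.
  egf-∂X : ∀ (p q : ℕ → Bool) e → (∀ n → p (suc n) ≡ q n) → ∀ i j l →
    ∂ X (egf p e) i j l ≡ weighted (q (i ℕ.+ j ℕ.+ l)) (e (suc i) j l) i j l
  egf-∂X p q e pq i j l = trans (weighted-∂X (p (suc (i ℕ.+ j ℕ.+ l))) (e (suc i) j l) i j l)
    (cong (λ r → weighted r (e (suc i) j l) i j l) (pq (i ℕ.+ j ℕ.+ l)))

  egf-∂Y : ∀ (p q : ℕ → Bool) e → (∀ n → p (suc n) ≡ q n) → ∀ i j l →
    ∂ Y (egf p e) i j l ≡ weighted (q (i ℕ.+ j ℕ.+ l)) (e i (suc j) l) i j l
  egf-∂Y p q e pq i j l = trans (weighted-∂Y (p (i ℕ.+ suc j ℕ.+ l)) (e i (suc j) l) i j l)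
    (cong (λ r → weighted r (e i (suc j) l) i j l)
      (trans (cong (λ n → p (n ℕ.+ l)) (ℕP.+-suc i j)) (pq (i ℕ.+ j ℕ.+ l))))

  egf-∂Z : ∀ (p q : ℕ → Bool) e → (∀ n → p (suc n) ≡ q n) → ∀ i j l →
    ∂ Z (egf p e) i j l ≡ weighted (q (i ℕ.+ j ℕ.+ l)) (e i j (suc l)) i j l
  egf-∂Z p q e pq i j l = trans (weighted-∂Z (p (i ℕ.+ j ℕ.+ suc l)) (e i j (suc l)) i j l)
    (cong (λ r → weighted r (e i j (suc l)) i j l)
      (trans (cong p (ℕP.+-suc (i ℕ.+ j) l)) (pq (i ℕ.+ j ℕ.+ l))))

  egf-diff-XY : ∀ (p q : ℕ → Bool) e d → (∀ n → p (suc n) ≡ q n) →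
    (∀ i j l → e (suc i) j l ≡ e i (suc j) l ℕ.+ d i j l) →
    ∂ X (egf p e) ≈ ∂ Y (egf p e) ⊞ egf q d
  egf-diff-XY p q e d pq step .at i j l = begin
    ∂ X (egf p e) i j l                              ≡⟨ egf-∂X p q e pq i j l ⟩
    weighted r (e (suc i) j l) i j l                  ≡⟨ cong (λ c → weighted r c i j l) (step i j l) ⟩
    weighted r (e i (suc j) l ℕ.+ d i j l) i j l      ≡⟨ weighted-+ r (e i (suc j) l) (d i j l) i j l ⟩
    weighted r (e i (suc j) l) i j l + egf q d i j l  ≡⟨ cong (λ t → t + egf q d i j l) (egf-∂Y p q e pq i j l) ⟨
    ∂ Y (egf p e) i j l + egf q d i j l              ∎
    where
    open ≡-Reasoning
    r : Bool
    r = q (i ℕ.+ j ℕ.+ l)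

  egf-diff-YX : ∀ (p q : ℕ → Bool) e d → (∀ n → p (suc n) ≡ q n) →
    (∀ i j l → e i (suc j) l ≡ e (suc i) j l ℕ.+ d i j l) →
    ∂ Y (egf p e) ≈ ∂ X (egf p e) ⊞ egf q d
  egf-diff-YX p q e d pq step .at i j l = begin
    ∂ Y (egf p e) i j l                              ≡⟨ egf-∂Y p q e pq i j l ⟩
    weighted r (e i (suc j) l) i j l                  ≡⟨ cong (λ c → weighted r c i j l) (step i j l) ⟩
    weighted r (e (suc i) j l ℕ.+ d i j l) i j l      ≡⟨ weighted-+ r (e (suc i) j l) (d i j l) i j l ⟩
    weighted r (e (suc i) j l) i j l + egf q d i j l  ≡⟨ cong (λ t → t + egf q d i j l) (egf-∂X p q e pq i j l) ⟨
    ∂ X (egf p e) i j l + egf q d i j l              ∎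
    where
    open ≡-Reasoning
    r : Bool
    r = q (i ℕ.+ j ℕ.+ l)

swap-sum : ∀ i l → l ℕ.+ 0 ℕ.+ i ≡ i ℕ.+ 0 ℕ.+ l
swap-sum i l rewrite ℕP.+-identityʳ i | ℕP.+-identityʳ l = ℕP.+-comm l i

module _ {a b : Mat} (T : TwinSeidel a b) where
  open Entries T

  opaque
    unfolding _⊞_

    private
      diag : ∀ i l → 1 ≤ i ℕ.+ l → egf isEven (lower b) l 0 i ≡ egf isEven (upper b) i 0 l + 0ℚ
      diag i l h = begin
        weighted (isEven (l ℕ.+ 0 ℕ.+ i)) (lower b l 0 i) l 0 i
          ≡⟨ cong₂ (λ n c → weighted (isEven n) c l 0 i) (swap-sum i l) (bl-diag i l h) ⟩
        weighted (isEven (i ℕ.+ 0 ℕ.+ l)) (upper b i 0 l) l 0 i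
          ≡⟨ weighted-swap (isEven (i ℕ.+ 0 ℕ.+ l)) (upper b i 0 l) i 0 l ⟩
        egf isEven (upper b) i 0 l
          ≡⟨ ℚP.+-identityʳ (egf isEven (upper b) i 0 l) ⟨
        egf isEven (upper b) i 0 l + 0ℚ ∎
        where open ≡-Reasoning

    twin-BL-diag : swap (egf isEven (lower b)) ≈[ everywhere ∩ Y =0 ] egf isEven (upper b) ⊞ 𝟙
    -- The constant terms are 1 below and 0 above the diagonal; `𝟙` makes up the difference.
    twin-BL-diag .at[] zero    zero zero    (_ , refl) =
      trans (cong (λ c → weighted true c 0 0 0) bl-origin)
        (cong (λ c → weighted true c 0 0 0 + 1ℚ) (sym (bu-face 0 0)))
    twin-BL-diag .at[] zero    zero (suc l) (_ , refl) = diag zero (suc l) (s≤s z≤n)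
    twin-BL-diag .at[] (suc i) zero l       (_ , refl) = diag (suc i) l (s≤s z≤n)

  twin-solution : Solution (egf isOdd (upper a)) (egf isOdd (lower a)) (egf isEven (upper b)) (egf isEven (lower b))
  twin-solution = record
    { AU-diff = egf-diff-YX isOdd isEven (upper a) (upper b) isOdd-suc au-step
    ; AL-diff = egf-diff-XY isOdd isEven (lower a) (lower b) isOdd-suc al-step
    ; BU-diff = egf-diff-XY isEven isOdd (upper b) (upper a) isEven-suc bu-step
    ; BL-diff = egf-diff-YX isEven isOdd (lower b) (lower a) isEven-suc bl-step
    ; BU-face = mk λ { zero j l (_ , refl) →
        trans (cong (λ c → weighted (isEven (j ℕ.+ l)) c 0 j l) (bu-face j l)) (weighted-0 (isEven (j ℕ.+ l)) 0 j l) }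
    ; AL-face = mk λ { zero j l (_ , refl) →
        trans (egf-∂Z isOdd isEven (lower a) isOdd-suc 0 j l)
          (cong (λ c → weighted (isEven (j ℕ.+ l)) c 0 j l) (al-face j l)) }
    ; AL-edge = mk λ
        { zero zero    zero ((_ , refl) , refl) → refl
        ; zero (suc j) zero ((_ , refl) , refl) →
            trans (cong (λ c → weighted (isOdd (suc j ℕ.+ 0)) c 0 (suc j) 0) (al-edge j)) (weighted-0 (isOdd (suc j ℕ.+ 0)) 0 (suc j) 0) }
    ; AU-diag = mk λ { i zero l (_ , refl) → sym (trans
        (cong₂ (λ n c → weighted (isOdd n) c l 0 i) (swap-sum i l) (sym (au-diag i l)))
        (weighted-swap (isOdd (i ℕ.+ 0 ℕ.+ l)) (upper a i 0 l) i 0 l)) }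
    ; BL-diag = twin-BL-diag
    }

-- Uniqueness of the solution

module Uniqueness {AU AL BU BL AU′ AL′ BU′ BL′ : Ser3}
  (σ : Solution AU AL BU BL) (σ′ : Solution AU′ AL′ BU′ BL′) where

  private
    module S₁ = Solution σ
    module S₂ = Solution σ′

  opaque
    unfolding _⊞_ ∂

    private
      X⇒Y : ∀ i j l {N} → suc i ℕ.+ j ℕ.+ l < N → i ℕ.+ suc j ℕ.+ l < N
      X⇒Y i j l {N} = subst (λ n → n ℕ.+ l < N) (sym (ℕP.+-suc i j))

      Y⇒X : ∀ i j l {N} → i ℕ.+ suc j ℕ.+ l < N → suc i ℕ.+ j ℕ.+ l < N
      Y⇒X i j l {N} = subst (λ n → n ℕ.+ l < N) (ℕP.+-suc i j)

      Z⇒X : ∀ j l {N} → 0 ℕ.+ j ℕ.+ suc l < N → suc (0 ℕ.+ j ℕ.+ l) < N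
      Z⇒X j l {N} = subst (_< N) (ℕP.+-suc j l)

      flip : ∀ i l {N} → i ℕ.+ 0 ℕ.+ l < N → l ℕ.+ 0 ℕ.+ i < N
      flip i l {N} = subst (_< N) (sym (swap-sum i l))

    -- `N` bounds the degree and drops whenever an equation passes between A and B. Within one
    -- degree, AL and BU trade x for y until x = 0; AU and BL trade y for x until y = 0, where the
    -- diagonal conditions hand them to AL and BU. No cycle arises, since AL and BU never call AU or
    -- BL in the same degree.
    AU-unique : ∀ N i j l → i ℕ.+ j ℕ.+ l < N → AU i j l ≡ AU′ i j l
    AL-unique : ∀ N i j l → i ℕ.+ j ℕ.+ l < N → AL i j l ≡ AL′ i j l
    BU-unique : ∀ N i j l → i ℕ.+ j ℕ.+ l < N → BU i j l ≡ BU′ i j l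
    BL-unique : ∀ N i j l → i ℕ.+ j ℕ.+ l < N → BL i j l ≡ BL′ i j l

    AL-unique (suc N) zero j zero h =
      trans (at[] S₁.AL-edge 0 j 0 ((tt , refl) , refl)) (sym (at[] S₂.AL-edge 0 j 0 ((tt , refl) , refl)))
    AL-unique (suc N) zero j (suc l) h = suc-cancel l (trans (at[] S₁.AL-face 0 j l (tt , refl))
      (trans (BL-unique N 0 j l (ℕP.≤-pred (Z⇒X j l h))) (sym (at[] S₂.AL-face 0 j l (tt , refl)))))
    AL-unique (suc N) (suc i) j l h = suc-cancel i (trans (at S₁.AL-diff i j l)
      (trans (cong₂ (λ p q → ℕ→ℚ (suc j) * p + q) (AL-unique (suc N) i (suc j) l (X⇒Y i j l h)) (BL-unique N i j l (ℕP.≤-pred h)))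
        (sym (at S₂.AL-diff i j l))))

    AU-unique (suc N) i zero l h = trans (at[] S₁.AU-diag i 0 l (tt , refl))
      (trans (AL-unique (suc N) l 0 i (flip i l h)) (sym (at[] S₂.AU-diag i 0 l (tt , refl))))
    AU-unique (suc N) i (suc j) l h = suc-cancel j (trans (at S₁.AU-diff i j l)
      (trans (cong₂ (λ p q → ℕ→ℚ (suc i) * p + q) (AU-unique (suc N) (suc i) j l (Y⇒X i j l h)) (BU-unique N i j l (ℕP.≤-pred (Y⇒X i j l h))))
        (sym (at S₂.AU-diff i j l))))

    BU-unique (suc N) zero j l h = trans (at[] S₁.BU-face 0 j l (tt , refl)) (sym (at[] S₂.BU-face 0 j l (tt , refl)))
    BU-unique (suc N) (suc i) j l h = suc-cancel i (trans (at S₁.BU-diff i j l)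
      (trans (cong₂ (λ p q → ℕ→ℚ (suc j) * p + q) (BU-unique (suc N) i (suc j) l (X⇒Y i j l h)) (AU-unique N i j l (ℕP.≤-pred h)))
        (sym (at S₂.BU-diff i j l))))

    BL-unique (suc N) i zero l h = trans (at[] S₁.BL-diag l 0 i (tt , refl))
      (trans (cong (_+ 𝟙 l 0 i) (BU-unique (suc N) l 0 i (flip i l h))) (sym (at[] S₂.BL-diag l 0 i (tt , refl))))
    BL-unique (suc N) i (suc j) l h = suc-cancel j (trans (at S₁.BL-diff i j l)
      (trans (cong₂ (λ p q → ℕ→ℚ (suc i) * p + q) (BL-unique (suc N) (suc i) j l (Y⇒X i j l h)) (AL-unique N i j l (ℕP.≤-pred (Y⇒X i j l h))))
        (sym (at S₂.BL-diff i j l))))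

  BU-agree : BU ≈ BU′
  BU-agree .at i j l = BU-unique (suc (i ℕ.+ j ℕ.+ l)) i j l ℕP.≤-refl

  BL-agree : BL ≈ BL′
  BL-agree .at i j l = BL-unique (suc (i ℕ.+ j ℕ.+ l)) i j l ℕP.≤-refl

-- Comparison with the stated generating functions

opaque
  unfolding _⊞_

  closedBU≡rhsUpper : closedBU ≡ rhsUpper
  closedBU≡rhsUpper = refl

  closedBL≡rhsLower : closedBL ≡ rhsLower
  closedBL≡rhsLower = refl

gfUpper-egf : ∀ b i j l → gfUpper b i j l ≡ egf isEven (upper b) i j l
gfUpper-egf b i j l
  rewrite ℕP.+-comm (i ℕ.+ j ℕ.+ l) 3 | ℕP.+-comm (i ℕ.+ j) 2 = refl

gfLower-egf : ∀ b i j l → gfLower b i j l ≡ egf isEven (lower b) i j l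
gfLower-egf b i j l
  rewrite ℕP.+-comm (i ℕ.+ j ℕ.+ l) 3 | ℕP.+-comm (j ℕ.+ l) 2 = refl

theorem1p6 : (a b : Mat) → TwinSeidel a b →
    (∀ i j l → gfUpper b i j l ≡ rhsUpper i j l) ×
    (∀ i j l → gfLower b i j l ≡ rhsLower i j l)
theorem1p6 a b T =
    (λ i j l → trans (gfUpper-egf b i j l)
      (trans (at BU-agree i j l) (cong (λ f → f i j l) closedBU≡rhsUpper)))
  , (λ i j l → trans (gfLower-egf b i j l)
      (trans (at BL-agree i j l) (cong (λ f → f i j l) closedBL≡rhsLower)))
  where open Uniqueness (twin-solution T) closed-solution
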